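{- Let $\Gamma$ be a Moore graph of diameter $2$ and valency $57$ (if one exists), let $L$ be its Laplacian matrix, and let $e_0$ denote the rank of $L$ over a field of characteristic $5$. Then either \[ \mathrm{Syl}_5(K(\Gamma))\cong(\mathbb{Z}/5\mathbb{Z})^{1520-e_0}\oplus(\mathbb{Z}/5^2\mathbb{Z})^{1732-e_0}\oplus(\mathbb{Z}/5^3\mathbb{Z})^{e_0-3} \] or \[ \mathrm{Syl}_5(K(\Gamma))\cong(\mathbb{Z}/5\mathbb{Z})^{1521-e_0}\oplus(\mathbb{Z}/5^2\mathbb{Z})^{1730-e_0}\oplus(\mathbb{Z}/5^3\mathbb{Z})^{e_0-2}. \]
   Context: A Moore graph of diameter $d$ and valency $k$ is a simple $k$-regular graph of diameter $d$ and girth $2d+1$. For a simple graph $\Gamma$ with adjacency matrix $A$ and diagonal degree matrix $D$, the Laplacian matrix is $L=D-A$, viewed as a homomorphism $\mathbb{Z}^{V(\Gamma)}\to\mathbb{Z}^{V(\Gamma)}$. The critical group $K(\Gamma)$ is the torsion subgroup of $\operatorname{coker} L=\mathbb{Z}^{V(\Gamma)}/\operatorname{im}(L)$, and $\mathrm{Syl}_5(K(\Gamma))$ denotes its Sylow $5$-subgroup. -}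

module Defs where

open import Data.Nat as ℕ using (ℕ; zero; suc; _≤_; _<_)
open import Data.Integer as ℤ using (ℤ; +_; _-_; -_)
open import Data.Integer.Divisibility using (_∣_)
open import Data.Fin using (Fin; zero; suc; _≟_)
open import Data.Bool using (Bool; true; false; if_then_else_)
open import Data.Vec using (Vec; replicate; lookup; _++_)
open import Data.Product using (Σ; ∃; _×_; _,_)
open import Relation.Nullary using (¬_; does)
open import Relation.Binary.PropositionalEquality using (_≡_)

Σℕ : (m : ℕ) → (Fin m → ℕ) → ℕ
Σℕ zero    f = 0
Σℕ (suc m) f = f zero ℕ.+ Σℕ m (λ i → f (suc i))

Σℤ : (m : ℕ) → (Fin m → ℤ) → ℤ
Σℤ zero    f = + 0
Σℤ (suc m) f = f zero ℤ.+ Σℤ m (λ i → f (suc i))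

record Graph (n : ℕ) : Set where
  field
    adj   : Fin n → Fin n → Bool
    sym   : ∀ u v → adj u v ≡ adj v u
    irrefl : ∀ v → adj v v ≡ false
open Graph public

b2ℕ : Bool → ℕ
b2ℕ true  = 1
b2ℕ false = 0

degree : ∀ {n} → Graph n → Fin n → ℕ
degree {n} G v = Σℕ n (λ w → b2ℕ (adj G v w))

Regular : ∀ {n} → Graph n → ℕ → Set
Regular G k = ∀ v → degree G v ≡ k

Walk : ∀ {n} → Graph n → Fin n → Fin n → ℕ → Set
Walk {n} G u v m =
  Σ (ℕ → Fin n) λ w →
    (w 0 ≡ u) × (w m ≡ v) × (∀ i → i < m → adj G (w i) (w (suc i)) ≡ true)

Dist : ∀ {n} → Graph n → Fin n → Fin n → ℕ → Set
Dist G u v m = Walk G u v m × (∀ m' → m' < m → ¬ Walk G u v m')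

Diameter : ∀ {n} → Graph n → ℕ → Set
Diameter G d =
  (∀ u v → ∃ λ m → m ≤ d × Dist G u v m) × (∃ λ u → ∃ λ v → Dist G u v d)

Cycle : ∀ {n} → Graph n → ℕ → Set
Cycle {n} G m =
  (3 ≤ m) × Σ (ℕ → Fin n) λ c →
    (∀ i j → i < m → j < m → c i ≡ c j → i ≡ j) ×
    (∀ i → i < m → adj G (c i) (c (suc i)) ≡ true) ×
    (c m ≡ c 0)

Girth : ∀ {n} → Graph n → ℕ → Set
Girth G g = Cycle G g × (∀ m → Cycle G m → g ≤ m)

MooreGraph : ∀ {n} → Graph n → (d k : ℕ) → Set
MooreGraph G d k = Regular G k × Diameter G d × Girth G (2 ℕ.* d ℕ.+ 1)

adjℤ : ∀ {n} → Graph n → Fin n → Fin n → ℤ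
adjℤ G u v = + b2ℕ (adj G u v)

laplacian : ∀ {n} → Graph n → Fin n → Fin n → ℤ
laplacian G u v =
  (if does (u ≟ v) then + degree G u else + 0) - adjℤ G u v

_·v_ : ∀ {n} → (Fin n → Fin n → ℤ) → (Fin n → ℤ) → (Fin n → ℤ)
_·v_ {n} M z i = Σℤ n (λ j → M i j ℤ.* z j)

-- rank over a field of characteristic 5 (i.e. over F_5)

ColsIndepMod5 : ∀ {n r} → (Fin n → Fin n → ℤ) → (Fin r → Fin n) → Set
ColsIndepMod5 {n} {r} M s =
  ∀ (c : Fin r → ℤ) →
    (∀ i → + 5 ∣ Σℤ r (λ j → c j ℤ.* M i (s j))) →
    ∀ j → + 5 ∣ c j

RankMod5 : ∀ {n} → (Fin n → Fin n → ℤ) → ℕ → Set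
RankMod5 {n} M e =
  (Σ (Fin e → Fin n) λ s → ColsIndepMod5 M s) ×
  (∀ (s : Fin (suc e) → Fin n) → ¬ ColsIndepMod5 M s)

InImage : ∀ {n} → (Fin n → Fin n → ℤ) → (Fin n → ℤ) → Set
InImage M x = ∃ λ z → ∀ i → (M ·v z) i ≡ x i

-- equality in coker M
_≈[_]_ : ∀ {n} → (Fin n → ℤ) → (Fin n → Fin n → ℤ) → (Fin n → ℤ) → Set
x ≈[ M ] y = InImage M (λ i → x i - y i)

-- class of x lies in the Sylow 5-subgroup of the torsion of coker M
-- (its order is a power of 5)
InSyl5 : ∀ {n} → (Fin n → Fin n → ℤ) → (Fin n → ℤ) → Set
InSyl5 M x = ∃ λ k → InImage M (λ i → + (5 ℕ.^ k) ℤ.* x i)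

-- Finite direct sums of cyclic groups ⊕_i ℤ/(m_i) as setoids on ℤ^r

_≈mod[_]_ : ∀ {r} → (Fin r → ℤ) → (Fin r → ℕ) → (Fin r → ℤ) → Set
x ≈mod[ ms ] y = ∀ i → + ms i ∣ (x i - y i)

-- Group isomorphism  ⊕_i ℤ/(ms i)  ≅  Syl_5(K(Γ))  (inside coker M),
-- given by a map on representatives.
Syl5Iso : ∀ {n r} → (Fin n → Fin n → ℤ) → (Fin r → ℕ) → Set
Syl5Iso {n} {r} M ms =
  Σ ((Fin r → ℤ) → (Fin n → ℤ)) λ f →
    (∀ x y → x ≈mod[ ms ] y → f x ≈[ M ] f y) ×
    (∀ x y → f (λ i → x i ℤ.+ y i) ≈[ M ] (λ i → f x i ℤ.+ f y i)) ×
    (∀ x → InSyl5 M (f x)) ×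
    (∀ x y → f x ≈[ M ] f y → x ≈mod[ ms ] y) ×
    (∀ y → InSyl5 M y → ∃ λ x → f x ≈[ M ] y)

moduli : (a b c : ℕ) → Fin (a ℕ.+ (b ℕ.+ c)) → ℕ
moduli a b c = lookup (replicate a 5 ++ replicate b 25 ++ replicate c 125)

Syl5Type : ∀ {n} → Graph n → (a b c : ℕ) → Set
Syl5Type G a b c = Syl5Iso (laplacian G) (moduli a b c)

{-# OPTIONS --safe #-}
-- The Laplacian satisfies L² = 115 L − 3250 + J with eigenvalues 50 (multiplicity 1729, read off
-- a trace) and 65 (multiplicity 1520) besides 0.  Write L = P ∘ diag d ∘ Q⁻¹ with P, Q unimodular.
-- Modulo 5, the eigenvectors for 50 lie in the span of the columns of Q with 25 ∣ d, while those
-- for 65 together with one column of L lie in the span of the columns of P with 25 ∤ d; since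
-- 1729 + 1521 = 3250, these bounds are sharp.  Next, {x : 125 ∣ L x} reduces modulo 5 to the image
-- under L of the vectors with coordinate sum 0, and ker L mod 5 consists of such vectors because
-- L² ≡ J; so 125 ∣ d holds for exactly e0 − 1 indices.  Finally d = 0 occurs once and any other d
-- divides 3250.  Hence it is always the second alternative that holds.
module Submission where

open import Defs renaming (sym to adj-sym)
open import Data.Bool using (true; false; if_then_else_)
open import Data.Empty using (⊥; ⊥-elim)
open import Data.Fin using (Fin; zero; suc; _≟_; splitAt; _↑ˡ_; _↑ʳ_)
open import Data.Fin.Permutation.Components using (transpose; transpose-inverse)
open import Data.Fin.Properties using (any?; all?; injective⇒≤; splitAt-↑ˡ; splitAt-↑ʳ; splitAt⁻¹-↑ˡ; splitAt⁻¹-↑ʳ; suc-injective; ¬∀⟶∃¬)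
open import Data.Integer using (ℤ; +_; -_; _+_; _-_; _*_; ∣_∣; NonZero; ≢-nonZero; _/_; _%_; _/ℕ_; _%ℕ_)
open import Data.Integer.DivMod using (n%d<d; a≡a%n+[a/n]*n; n%ℕd<d; a≡a%ℕn+[a/ℕn]*n)
open import Data.Integer.Divisibility.Signed using (_∣_; divides; _∣?_; ∣ᵤ⇒∣; ∣⇒∣ᵤ; ∣-trans; ∣m∣n⇒∣m+n; ∣m∣n⇒∣m-n; ∣m⇒∣m*n; ∣n⇒∣m*n; ∣m+n∣m⇒∣n; ∣m+n∣n⇒∣m)
open import Data.Integer.Properties using (abs-*; pos-*; +-injective; ∣i∣≡0⇒i≡0; +-identityˡ; +-identityʳ; +-inverseʳ; +-assoc; +-commutativeSemigroup; *-identityˡ; *-identityʳ; *-zeroˡ; *-zeroʳ; *-comm; *-assoc; *-distribˡ-+; *-distribʳ-+; *-cancelˡ-≡; *-cancelʳ-≡; *-commutativeSemigroup) renaming (_≟_ to _≟ℤ_)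
open import Algebra.Properties.CommutativeSemigroup +-commutativeSemigroup using (interchange)
open import Algebra.Properties.CommutativeSemigroup *-commutativeSemigroup using (x∙yz≈y∙xz)
open import Data.Integer.Tactic.RingSolver using (solve-∀)
open import Data.Nat as ℕ using (ℕ; zero; suc)
import Data.Nat.Divisibility as ℕ
open import Data.Nat.Primality using (Prime; prime?; euclidsLemma)
import Data.Nat.Properties as ℕ
open import Data.Product using (∃; _×_; _,_; proj₁; proj₂)
open import Data.Sum using (_⊎_; inj₁; inj₂; [_,_]′)
open import Data.Unit using (⊤; tt)
open import Data.Vec using (Vec; replicate; _++_; lookup)
open import Data.Vec.Properties using (lookup-splitAt; lookup-replicate)
open import Function using (_∘_; case_of_)
open import Relation.Binary.PropositionalEquality using (_≡_; _≢_; _≗_; refl; sym; trans; cong; cong₂; subst)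
open import Relation.Nullary using (¬_; ¬?; Dec; does; yes; no; _×-dec_)
open import Relation.Nullary.Decidable using (dec-true; dec-false; decidable-stable; from-yes; from-no)

-- The eigenvalues are 50 = 2·5² and 65 = 13·5, with product 3250 = 26·125. On vectors of coordinate
-- sum 0 the operators L and L - 115 multiply to -26·125, and they agree modulo 5; this ties the
-- diagonal entries divisible by 125 to those prime to 5. The obstacle is the all-ones vector: 5
-- divides 3250, so modulo 5 it has coordinate sum 0 itself. Counting eigenvectors alone accounts
-- for 1729 + 1520 = 3249 indices, and the two alternatives differ in the side on which the
-- remaining one falls. A column u of L settles this: L u is congruent to the all-ones vector, while
-- L kills modulo 5 the vectors to which u is adjoined. Arguments over F_5 are made with integer
-- vectors, and the dimension bounds share one shape: a linear map that is injective modulo 5 forces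
-- an inequality.

-- Finite sums of integers.

Σ-cong : ∀ n {f g : Fin n → ℤ} → f ≗ g → Σℤ n f ≡ Σℤ n g
Σ-cong zero    eq = refl
Σ-cong (suc n) eq = cong₂ _+_ (eq zero) (Σ-cong n (eq ∘ suc))

Σ-+ : ∀ n (f g : Fin n → ℤ) → Σℤ n (λ i → f i + g i) ≡ Σℤ n f + Σℤ n g
Σ-+ zero    f g = refl
Σ-+ (suc n) f g = trans (cong (_+_ (f zero + g zero)) (Σ-+ n (f ∘ suc) (g ∘ suc)))
  (interchange (f zero) (g zero) _ _)

Σ-* : ∀ n k (f : Fin n → ℤ) → Σℤ n (λ i → k * f i) ≡ k * Σℤ n f
Σ-* zero    k f = sym (*-zeroʳ k)
Σ-* (suc n) k f = trans (cong (_+_ (k * f zero)) (Σ-* n k (f ∘ suc))) (sym (*-distribˡ-+ k _ _))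

Σ-zero : ∀ n {f : Fin n → ℤ} → (∀ i → f i ≡ + 0) → Σℤ n f ≡ + 0
Σ-zero zero    eq = refl
Σ-zero (suc n) eq = cong₂ _+_ (eq zero) (Σ-zero n (eq ∘ suc))

Σ-single : ∀ n {f : Fin n → ℤ} k → (∀ i → i ≢ k → f i ≡ + 0) → Σℤ n f ≡ f k
Σ-single (suc n) {f} zero eq =
  trans (cong (_+_ (f zero)) (Σ-zero n (λ i → eq (suc i) λ ()))) (+-identityʳ _)
Σ-single (suc n) (suc k) eq =
  trans (cong₂ _+_ (eq zero λ ()) (Σ-single n k (λ i i≢k → eq (suc i) (λ { refl → i≢k refl })))) (+-identityˡ _)

Σ-swap : ∀ m n (f : Fin m → Fin n → ℤ) →
  Σℤ m (λ i → Σℤ n (f i)) ≡ Σℤ n (λ j → Σℤ m (λ i → f i j))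
Σ-swap zero    n f = sym (Σ-zero n (λ _ → refl))
Σ-swap (suc m) n f = trans (cong (_+_ (Σℤ n (f zero))) (Σ-swap m n (f ∘ suc)))
  (sym (Σ-+ n (f zero) (λ j → Σℤ m (λ i → f (suc i) j))))

-- Integer vectors and linear maps.

V : ℕ → Set
V n = Fin n → ℤ

infixl 6 _⊕_
infixr 7 _⊙_ _⊗_

_⊕_ : ∀ {n} → V n → V n → V n
(x ⊕ y) i = x i + y i

_⊙_ : ∀ {n} → ℤ → V n → V n
(k ⊙ x) i = k * x i

_⊗_ : ∀ {n} → V n → V n → V n
(x ⊗ y) i = x i * y i

0v : ∀ {n} → V n
0v _ = + 0

1v : ∀ {n} → V n
1v _ = + 1

unit : ∀ {n} → Fin n → V n
unit j i = if does (j ≟ i) then + 1 else + 0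

cons : ∀ {n} → ℤ → V n → V (suc n)
cons a x zero    = a
cons a x (suc i) = x i

unit-≡ : ∀ {n} (i : Fin n) → unit i i ≡ + 1
unit-≡ i rewrite dec-true (i ≟ i) refl = refl

unit-≢ : ∀ {n} {i j : Fin n} → i ≢ j → unit i j ≡ + 0
unit-≢ {i = i} {j} i≢j rewrite dec-false (i ≟ j) i≢j = refl

-- Vectors are functions compared by `≗`, so respect for pointwise equality has to be a field beside
-- additivity and homogeneity.
record Lin (m n : ℕ) : Set where
  field
    ap      : V m → V n
    ap-cong : ∀ {x y} → x ≗ y → ap x ≗ ap y
    ap-⊕    : ∀ x y → ap (x ⊕ y) ≗ ap x ⊕ ap y
    ap-⊙    : ∀ k x → ap (k ⊙ x) ≗ k ⊙ ap x

  ap-0 : ap 0v ≗ 0v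
  ap-0 i = trans (ap-⊙ (+ 0) 0v i) (*-zeroˡ (ap 0v i))

open Lin public

infixr 9 _∘ₗ_

idₗ : ∀ {n} → Lin n n
idₗ = record { ap = λ x → x ; ap-cong = λ eq → eq ; ap-⊕ = λ _ _ _ → refl ; ap-⊙ = λ _ _ _ → refl }

_∘ₗ_ : ∀ {l m n} → Lin m n → Lin l m → Lin l n
f ∘ₗ g = record
  { ap      = λ x → ap f (ap g x)
  ; ap-cong = λ eq → ap-cong f (ap-cong g eq)
  ; ap-⊕    = λ x y i → trans (ap-cong f (ap-⊕ g x y) i) (ap-⊕ f (ap g x) (ap g y) i)
  ; ap-⊙    = λ k x i → trans (ap-cong f (ap-⊙ g k x) i) (ap-⊙ f k (ap g x) i)
  }

infixl 6 _+ₗ_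
infixr 7 _*ₗ_

_+ₗ_ : ∀ {m n} → Lin m n → Lin m n → Lin m n
f +ₗ g = record
  { ap      = λ x → ap f x ⊕ ap g x
  ; ap-cong = λ eq i → cong₂ _+_ (ap-cong f eq i) (ap-cong g eq i)
  ; ap-⊕    = λ x y i → trans (cong₂ _+_ (ap-⊕ f x y i) (ap-⊕ g x y i)) (interchange (ap f x i) _ _ _)
  ; ap-⊙    = λ k x i → trans (cong₂ _+_ (ap-⊙ f k x i) (ap-⊙ g k x i)) (sym (*-distribˡ-+ k (ap f x i) (ap g x i)))
  }

_*ₗ_ : ∀ {m n} → ℤ → Lin m n → Lin m n
c *ₗ f = record
  { ap      = λ x → c ⊙ ap f x
  ; ap-cong = λ eq i → cong (c *_) (ap-cong f eq i)
  ; ap-⊕    = λ x y i → trans (cong (c *_) (ap-⊕ f x y i)) (*-distribˡ-+ c (ap f x i) (ap f y i))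
  ; ap-⊙    = λ k x i → trans (cong (c *_) (ap-⊙ f k x i)) (x∙yz≈y∙xz c k (ap f x i))
  }

diag : ∀ {n} → V n → Lin n n
diag d = record
  { ap      = d ⊗_
  ; ap-cong = λ eq i → cong (d i *_) (eq i)
  ; ap-⊕    = λ x y i → *-distribˡ-+ (d i) (x i) (y i)
  ; ap-⊙    = λ k x i → x∙yz≈y∙xz (d i) k (x i)
  }

restrict : ∀ {m n} → (Fin m → Fin n) → Lin n m
restrict ι = record
  { ap = λ x k → x (ι k) ; ap-cong = λ eq k → eq (ι k) ; ap-⊕ = λ _ _ _ → refl ; ap-⊙ = λ _ _ _ → refl }

combine : ∀ {r n} → (Fin r → V n) → Lin r n
combine {r} v = record
  { ap      = λ x i → Σℤ r (λ k → x k * v k i)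
  ; ap-cong = λ eq i → Σ-cong r (λ k → cong (_* v k i) (eq k))
  ; ap-⊕    = λ x y i → trans (Σ-cong r (λ k → *-distribʳ-+ (v k i) (x k) (y k))) (Σ-+ r (λ k → x k * v k i) _)
  ; ap-⊙    = λ c x i → trans (Σ-cong r (λ k → *-assoc c (x k) (v k i))) (Σ-* r c (λ k → x k * v k i))
  }

sumₗ : ∀ {m} → Lin m 1
sumₗ = combine (λ _ → 1v)

total : ∀ {n} → V n → ℤ
total {n} = Σℤ n

sumₗ-total : ∀ {m} (x : V m) i → ap sumₗ x i ≡ total x
sumₗ-total {m} x i = Σ-cong m (λ k → *-identityʳ (x k))

infixr 5 _⊞_

_⊞_ : ∀ {l n} → Lin l 1 → Lin l n → Lin l (suc n)
f ⊞ g = record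
  { ap      = λ x → cons (ap f x zero) (ap g x)
  ; ap-cong = λ { eq zero → ap-cong f eq zero ; eq (suc i) → ap-cong g eq i }
  ; ap-⊕    = λ { x y zero → ap-⊕ f x y zero ; x y (suc i) → ap-⊕ g x y i }
  ; ap-⊙    = λ { k x zero → ap-⊙ f k x zero ; k x (suc i) → ap-⊙ g k x i }
  }

headₗ : ∀ {n} → Lin (suc n) 1
headₗ = restrict (λ _ → zero)

tailₗ : ∀ {n} → Lin (suc n) n
tailₗ = restrict suc

zeroₗ : ∀ {m n} → Lin m n
zeroₗ = record { ap = λ _ → 0v ; ap-cong = λ _ _ → refl ; ap-⊕ = λ _ _ _ → refl ; ap-⊙ = λ k _ _ → sym (*-zeroʳ k) }

combine-image : ∀ {r m n} (f : Lin m n) (v : Fin r → V m) x →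
  ap f (ap (combine v) x) ≗ ap (combine (λ k → ap f (v k))) x
combine-image {zero}  f v x i = ap-0 f i
combine-image {suc r} f v x i =
  trans (ap-⊕ f (x zero ⊙ v zero) (ap (combine (v ∘ suc)) (x ∘ suc)) i)
    (cong₂ _+_ (ap-⊙ f (x zero) (v zero) i) (combine-image f (v ∘ suc) (x ∘ suc) i))

combine-unit : ∀ {n} (x : V n) → ap (combine unit) x ≗ x
combine-unit {n} x i =
  trans (Σ-single n i (λ k k≢i → trans (cong (x k *_) (unit-≢ k≢i)) (*-zeroʳ (x k))))
    (trans (cong (x i *_) (unit-≡ i)) (*-identityʳ (x i)))

expand : ∀ {m n} (f : Lin m n) x → ap f x ≗ ap (combine (λ k → ap f (unit k))) x
expand f x i = trans (ap-cong f (λ j → sym (combine-unit x j)) i) (combine-image f unit x i)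

-- Unimodular maps and elementary operations.

record Iso (n : ℕ) : Set where
  field
    to      : Lin n n
    from    : Lin n n
    to-from : ∀ x → ap to (ap from x) ≗ x
    from-to : ∀ x → ap from (ap to x) ≗ x

open Iso public

idᵢ : ∀ {n} → Iso n
idᵢ = record { to = idₗ ; from = idₗ ; to-from = λ _ _ → refl ; from-to = λ _ _ → refl }

_∘ᵢ_ : ∀ {n} → Iso n → Iso n → Iso n
P ∘ᵢ Q = record
  { to      = to P ∘ₗ to Q
  ; from    = from Q ∘ₗ from P
  ; to-from = λ x i → trans (ap-cong (to P) (to-from Q (ap (from P) x)) i) (to-from P x i)
  ; from-to = λ x i → trans (ap-cong (from Q) (from-to P (ap (to Q) x)) i) (from-to Q x i)
  }

flipᵢ : ∀ {n} → Iso n → Iso n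
flipᵢ P = record { to = from P ; from = to P ; to-from = from-to P ; from-to = to-from P }

transpose-left : ∀ {n} (i j : Fin n) → transpose i j i ≡ j
transpose-left i j rewrite dec-true (i ≟ i) refl = refl

transpose-right : ∀ {n} (i j : Fin n) → transpose i j j ≡ i
transpose-right i j with j ≟ i
... | yes j≡i = j≡i
... | no  _ rewrite dec-true (j ≟ j) refl = refl

swapᵢ : ∀ {n} → Fin n → Fin n → Iso n
swapᵢ i j = record
  { to      = restrict (transpose i j)
  ; from    = restrict (transpose j i)
  ; to-from = λ x k → cong x (transpose-inverse j i)
  ; from-to = λ x k → cong x (transpose-inverse i j)
  }

swap-unit : ∀ {n} (i j : Fin n) → ap (to (swapᵢ i j)) (unit i) ≗ unit j
swap-unit i j k with j ≟ k
... | yes refl = trans (cong (unit i) (transpose-right i j)) (unit-≡ i)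
... | no  j≢k  = unit-≢ {i = i} {j = transpose i j k} λ i≡ → j≢k
      (trans (sym (transpose-right j i)) (trans (cong (transpose j i) i≡) (transpose-inverse j i)))

rowShear : ∀ {n} → V n → Iso (suc n)
rowShear q = record
  { to      = shear q
  ; from    = shear (- + 1 ⊙ q)
  ; to-from = λ { x zero → refl ; x (suc i) → cancel (x zero) (x (suc i)) (q i) }
  ; from-to = λ { x zero → refl ; x (suc i) → cancel′ (x zero) (x (suc i)) (q i) }
  }
  where
  shear : ∀ {n} → V n → Lin (suc n) (suc n)
  shear q = headₗ ⊞ (tailₗ +ₗ (combine (λ _ → q) ∘ₗ headₗ))
  cancel : ∀ a b c → b + (a * (- + 1 * c) + + 0) + (a * c + + 0) ≡ b
  cancel = solve-∀
  cancel′ : ∀ a b c → b + (a * c + + 0) + (a * (- + 1 * c) + + 0) ≡ b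
  cancel′ = solve-∀

colShear : ∀ {n} → V n → Iso (suc n)
colShear {n} q = record
  { to      = shear q
  ; from    = shear (- + 1 ⊙ q)
  ; to-from = λ { x zero → trans (cong (λ s → x zero + s + Σℤ n (λ j → x (suc j) * q j)) (negate x)) (cancel (x zero) _) ; x (suc i) → refl }
  ; from-to = λ { x zero → trans (cong (λ s → x zero + Σℤ n (λ j → x (suc j) * q j) + s) (negate x)) (cancel′ (x zero) _) ; x (suc i) → refl }
  }
  where
  shear : ∀ {n} → V n → Lin (suc n) (suc n)
  shear q = (headₗ +ₗ (combine (λ j _ → q j) ∘ₗ tailₗ)) ⊞ tailₗ
  negate : ∀ x → Σℤ n (λ j → x (suc j) * (- + 1 * q j)) ≡ - + 1 * Σℤ n (λ j → x (suc j) * q j)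
  negate x = trans (Σ-cong n (λ j → x∙yz≈y∙xz (x (suc j)) (- + 1) (q j))) (Σ-* n (- + 1) (λ j → x (suc j) * q j))
  cancel : ∀ a b → a + - + 1 * b + b ≡ a
  cancel = solve-∀
  cancel′ : ∀ a b → a + b + - + 1 * b ≡ a
  cancel′ = solve-∀

colShear-unit-zero : ∀ {n} (q : V n) → ap (to (colShear q)) (unit zero) ≗ unit zero
colShear-unit-zero {n} q zero    = cong (_+_ (+ 1)) (Σ-zero n (λ j → *-zeroˡ (q j)))
colShear-unit-zero     q (suc i) = refl

colShear-unit-suc : ∀ {n} (q : V n) j →
  ap (to (colShear q)) (unit (suc j)) ≗ unit (suc j) ⊕ q j ⊙ unit zero
colShear-unit-suc {n} q j zero = cong (_+_ (+ 0))
  (trans (Σ-single n j (λ k k≢j → trans (cong (_* q k) (unit-≢ (k≢j ∘ sym))) (*-zeroˡ (q k))))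
    (trans (cong (_* q j) (unit-≡ j)) (*-comm (+ 1) (q j))))
colShear-unit-suc q j (suc i) = sym (trans (cong (_+_ (unit j i)) (*-zeroʳ (q j))) (+-identityʳ _))

1⊕_ : ∀ {n} → Iso n → Iso (suc n)
1⊕ P = record
  { to      = headₗ ⊞ (to P ∘ₗ tailₗ)
  ; from    = headₗ ⊞ (from P ∘ₗ tailₗ)
  ; to-from = λ { x zero → refl ; x (suc i) → to-from P (x ∘ suc) i }
  ; from-to = λ { x zero → refl ; x (suc i) → from-to P (x ∘ suc) i }
  }

-- Diagonalization over the integers.

-- The factorization reads B Q = P diag d with `P` and `Q` unimodular. The entries of `d` come in no
-- particular order; what is counted later is how many of them are 0 or divisible by a given power
-- of 5.
record Diagonalization {n} (B : Lin n n) : Set where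
  field
    P Q      : Iso n
    d        : V n
    diagonal : ∀ x → ap B (ap (to Q) x) ≗ ap (to P) (d ⊗ x)

diagonalize-conj : ∀ {n} {B : Lin n n} (P Q : Iso n) →
  Diagonalization (to P ∘ₗ B ∘ₗ to Q) → Diagonalization B
diagonalize-conj {B = B} P Q D = record
  { P        = flipᵢ P ∘ᵢ D.P
  ; Q        = Q ∘ᵢ D.Q
  ; d        = D.d
  ; diagonal = λ x i → trans (sym (from-to P (ap B (ap (to Q) (ap (to D.Q) x))) i))
                             (ap-cong (from P) (D.diagonal x) i)
  }
  where
  module D = Diagonalization D

diagonalize-block : ∀ {n} {B : Lin (suc n) (suc n)} a →
  ap B (unit zero) ≗ a ⊙ unit zero → (∀ j → ap B (unit (suc j)) zero ≡ + 0) →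
  Diagonalization (tailₗ ∘ₗ B ∘ₗ (zeroₗ ⊞ idₗ)) → Diagonalization B
diagonalize-block {n} {B} a col row D = record
  { P        = 1⊕ D.P
  ; Q        = 1⊕ D.Q
  ; d        = cons a D.d
  ; diagonal = diagonal
  }
  where
  module D = Diagonalization D
  split : ∀ b (y : V n) → cons b y ≗ b ⊙ unit zero ⊕ cons (+ 0) y
  split b y zero    = lem b
    where
    lem : ∀ b → b ≡ b * + 1 + + 0
    lem = solve-∀
  split b y (suc i) = lem b (y i)
    where
    lem : ∀ b c → c ≡ b * + 0 + c
    lem = solve-∀
  B-cons : ∀ b y i → ap B (cons b y) i ≡ b * (a * unit zero i) + ap B (cons (+ 0) y) i
  B-cons b y i = trans (ap-cong B (split b y) i) (trans (ap-⊕ B (b ⊙ unit zero) (cons (+ 0) y) i)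
    (cong (_+ ap B (cons (+ 0) y) i) (trans (ap-⊙ B b (unit zero) i) (cong (b *_) (col i)))))
  head-zero : ∀ y → ap B (cons (+ 0) y) zero ≡ + 0
  head-zero y = trans (expand B (cons (+ 0) y) zero)
    (cong₂ _+_ (*-zeroˡ (ap B (unit zero) zero))
      (Σ-zero n (λ j → trans (cong (y j *_) (row j)) (*-zeroʳ (y j)))))
  diagonal : ∀ x → ap B (cons (x zero) (ap (to D.Q) (x ∘ suc))) ≗ cons (a * x zero) (ap (to D.P) (D.d ⊗ (x ∘ suc)))
  diagonal x zero    = trans (B-cons (x zero) _ zero) (trans (cong (_+_ (x zero * (a * + 1))) (head-zero _)) (lem (x zero) a))
    where
    lem : ∀ b a → b * (a * + 1) + + 0 ≡ a * b
    lem = solve-∀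
  diagonal x (suc i) = trans (B-cons (x zero) _ (suc i)) (trans (lem (x zero) a _)
    (trans (ap-cong B (λ { zero → refl ; (suc i) → refl }) (suc i)) (D.diagonal (x ∘ suc) i)))
    where
    lem : ∀ b a c → b * (a * + 0) + c ≡ c
    lem = solve-∀

remainder : ∀ b a .{{_ : NonZero a}} → b + a * (- + 1 * (b / a)) ≡ + (b % a)
remainder b a = trans (cong (λ c → c + a * (- + 1 * (b / a))) (a≡a%n+[a/n]*n b a)) (lem (+ (b % a)) (b / a) a)
  where
  lem : ∀ r q a → r + q * a + a * (- + 1 * q) ≡ r
  lem = solve-∀

-- The induction measure of the elimination is a bound on one nonzero entry. A nonzero remainder is
-- strictly smaller than the pivot, so it is a pivot under the next lower bound.
PivotBelow : ℕ → ℕ → Set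
PivotBelow n k = ∀ (B : Lin n n) i j → ap B (unit j) i ≢ + 0 → ∣ ap B (unit j) i ∣ ℕ.≤ k → Diagonalization B

-- The column of the pivot is already clear, so subtracting multiples of column zero from the others
-- alters row zero only. A surviving remainder restarts the elimination with a smaller pivot;
-- otherwise the pivot splits off as a block of size 1.
clear-row : ∀ {n k} → (∀ (B : Lin n n) → Diagonalization B) → PivotBelow (suc n) k →
  ∀ (B : Lin (suc n) (suc n)) a .{{_ : NonZero a}} → ∣ a ∣ ℕ.≤ suc k →
  ap B (unit zero) ≗ a ⊙ unit zero → Diagonalization B
clear-row {n} {k} IH rec B a ≤k col = diagonalize-conj idᵢ (colShear q)
  (case any? (λ j → ¬? (ap B′ (unit (suc j)) zero ≟ℤ + 0)) of λ
    { (yes (j , ≢0)) → rec B′ zero (suc j) ≢0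
        (subst (ℕ._≤ k) (cong ∣_∣ (sym (rem j))) (ℕ.≤-pred (ℕ.≤-trans (n%d<d (ap B (unit (suc j)) zero) a) ≤k)))
    ; (no ¬∃) → diagonalize-block a
        (λ i → trans (ap-cong B (colShear-unit-zero q) i) (col i))
        (λ j → decidable-stable (ap B′ (unit (suc j)) zero ≟ℤ + 0) (λ ≢0 → ¬∃ (j , ≢0))) (IH _)
    })
  where
  q : V n
  q j = - + 1 * (ap B (unit (suc j)) zero / a)
  B′ = to idᵢ ∘ₗ B ∘ₗ to (colShear q)
  lem : ∀ b c → b * (c * + 1) ≡ c * b
  lem = solve-∀
  rem : ∀ j → ap B′ (unit (suc j)) zero ≡ + (ap B (unit (suc j)) zero % a)
  rem j = trans (ap-cong B (colShear-unit-suc q j) zero)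
    (trans (ap-⊕ B (unit (suc j)) (q j ⊙ unit zero) zero)
      (trans (cong (_+_ (ap B (unit (suc j)) zero))
               (trans (ap-⊙ B (q j) (unit zero) zero) (trans (cong (q j *_) (col zero)) (lem (q j) a))))
        (remainder (ap B (unit (suc j)) zero) a)))

clear-column : ∀ {n k} → (∀ (B : Lin n n) → Diagonalization B) → PivotBelow (suc n) k →
  ∀ (B : Lin (suc n) (suc n)) a .{{_ : NonZero a}} → ∣ a ∣ ℕ.≤ suc k →
  ap B (unit zero) zero ≡ a → Diagonalization B
clear-column {n} {k} IH rec B a ≤k pivot = diagonalize-conj (rowShear q) idᵢ
  (case any? (λ i → ¬? (ap B′ (unit zero) (suc i) ≟ℤ + 0)) of λ
    { (yes (i , ≢0)) → rec B′ (suc i) zero ≢0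
        (subst (ℕ._≤ k) (cong ∣_∣ (sym (rem i))) (ℕ.≤-pred (ℕ.≤-trans (n%d<d (ap B (unit zero) (suc i)) a) ≤k)))
    ; (no ¬∃) → clear-row IH rec B′ a ≤k
        (λ { zero → trans pivot (sym (*-identityʳ a))
           ; (suc i) → trans (decidable-stable (ap B′ (unit zero) (suc i) ≟ℤ + 0) (λ ≢0 → ¬∃ (i , ≢0))) (sym (*-zeroʳ a)) })
    })
  where
  q : V n
  q i = - + 1 * (ap B (unit zero) (suc i) / a)
  B′ = to (rowShear q) ∘ₗ B ∘ₗ to idᵢ
  rem : ∀ i → ap B′ (unit zero) (suc i) ≡ + (ap B (unit zero) (suc i) % a)
  rem i = trans (cong (_+_ (ap B (unit zero) (suc i)))
      (trans (+-identityʳ (ap B (unit zero) zero * q i)) (cong (_* q i) pivot)))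
    (remainder (ap B (unit zero) (suc i)) a)

diagonalize-pivot : ∀ {n} → (∀ (B : Lin n n) → Diagonalization B) → ∀ k → PivotBelow (suc n) k
diagonalize-pivot IH zero    B i j ≢0 ≤k = ⊥-elim (≢0 (∣i∣≡0⇒i≡0 (ℕ.n≤0⇒n≡0 ≤k)))
diagonalize-pivot IH (suc k) B i j ≢0 ≤k = diagonalize-conj (swapᵢ zero i) (swapᵢ zero j)
  (clear-column IH (diagonalize-pivot IH k) (to (swapᵢ zero i) ∘ₗ B ∘ₗ to (swapᵢ zero j))
    (ap B (unit j) i) {{≢-nonZero ≢0}} ≤k
    (trans (ap-cong B (swap-unit zero j) (transpose zero i zero)) (cong (ap B (unit j)) (transpose-left zero i))))

abstract
  diagonalize : ∀ {n} (B : Lin n n) → Diagonalization B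
  diagonalize {zero}  B = record { P = idᵢ ; Q = idᵢ ; d = 0v ; diagonal = λ x () }
  diagonalize {suc n} B with any? (λ i → any? (λ j → ¬? (ap B (unit j) i ≟ℤ + 0)))
  ... | yes (i , j , ≢0) = diagonalize-pivot diagonalize _ B i j ≢0 ℕ.≤-refl
  ... | no ¬∃ = record
    { P = idᵢ ; Q = idᵢ ; d = 0v
    ; diagonal = λ x i → trans (expand B x i) (trans (Σ-zero (suc n) (λ j →
        trans (cong (x j *_) (decidable-stable (_ ≟ℤ + 0) (λ ≢0 → ¬∃ (i , j , ≢0)))) (*-zeroʳ (x j)))) (sym (*-zeroˡ (x i))))
    }

-- Divisibility by 5 and dimension over F_5.

prime5 : Prime 5
prime5 = from-yes (prime? 5)

5∤1 : ¬ (+ 5 ∣ + 1)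
5∤1 (divides (+ zero) ())
5∤1 (divides (+ suc zero) ())
5∤1 (divides (+ suc (suc n)) ())

euclid5 : ∀ a {b} → ¬ (+ 5 ∣ a) → + 5 ∣ a * b → + 5 ∣ b
euclid5 a {b} 5∤a 5∣ab with euclidsLemma ∣ a ∣ ∣ b ∣ prime5 (subst (5 ℕ.∣_) (abs-* a b) (∣⇒∣ᵤ 5∣ab))
... | inj₁ 5∣a = ⊥-elim (5∤a (∣ᵤ⇒∣ 5∣a))
... | inj₂ 5∣b = ∣ᵤ⇒∣ 5∣b

inverse5 : ∀ a → ¬ (+ 5 ∣ a) → ∃ λ t → + 5 ∣ t * a - + 1
inverse5 a 5∤a with a %ℕ 5 | a /ℕ 5 | n%ℕd<d a 5 | a≡a%ℕn+[a/ℕn]*n a 5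
... | 0 | q | _ | eq = ⊥-elim (5∤a (divides q (trans eq (+-identityˡ _))))
... | 1 | q | _ | refl = + 1 , divides q (lem q)
  where
  lem : ∀ q → + 1 * (+ 1 + q * + 5) - + 1 ≡ q * + 5
  lem = solve-∀
... | 2 | q | _ | refl = + 3 , divides (+ 1 + + 3 * q) (lem q)
  where
  lem : ∀ q → + 3 * (+ 2 + q * + 5) - + 1 ≡ (+ 1 + + 3 * q) * + 5
  lem = solve-∀
... | 3 | q | _ | refl = + 2 , divides (+ 1 + + 2 * q) (lem q)
  where
  lem : ∀ q → + 2 * (+ 3 + q * + 5) - + 1 ≡ (+ 1 + + 2 * q) * + 5
  lem = solve-∀
... | 4 | q | _ | refl = + 4 , divides (+ 3 + + 4 * q) (lem q)
  where
  lem : ∀ q → + 4 * (+ 4 + q * + 5) - + 1 ≡ (+ 3 + + 4 * q) * + 5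
  lem = solve-∀
... | suc (suc (suc (suc (suc _)))) | q | ℕ.s≤s (ℕ.s≤s (ℕ.s≤s (ℕ.s≤s (ℕ.s≤s ())))) | _

infix 4 _∣ᵥ_

_∣ᵥ_ : ∀ {n} → ℤ → V n → Set
k ∣ᵥ x = ∀ i → k ∣ x i

∣ᵥ-ap : ∀ {m n k} (f : Lin m n) {x} → k ∣ᵥ x → k ∣ᵥ ap f x
∣ᵥ-ap {k = k} f {x} k∣x i = divides (ap f q i)
  (trans (ap-cong f (λ j → trans (_∣_.equality (k∣x j)) (*-comm (q j) k)) i)
    (trans (ap-⊙ f k q i) (*-comm k (ap f q i))))
  where
  q = λ j → _∣_.quotient (k∣x j)

∣-resp : ∀ {k a b} → a ≡ b → k ∣ a → k ∣ b
∣-resp refl k∣a = k∣a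

iso-∣ᵥ : ∀ {n k} (P : Iso n) {x} → k ∣ᵥ ap (to P) x → k ∣ᵥ x
iso-∣ᵥ P {x} k∣Px i = ∣-resp (from-to P x i) (∣ᵥ-ap (from P) k∣Px i)

-- Injectivity of the induced map over F_5, phrased with integer representatives so that
-- divisibility by 25 and 125 can enter the same arguments.
Inj5 : ∀ {m n} → Lin m n → Set
Inj5 f = ∀ x → + 5 ∣ᵥ ap f x → + 5 ∣ᵥ x

-- Elimination on the first basis vector: injectivity gives its image an entry `a` prime to 5.
-- `lift` sends x to (-h, a x), where h is the pivot entry of the image of (0, x), so the new pivot
-- entry is -h a + a h = 0. Scaling by `a` replaces division and is harmless modulo 5.
inj5⇒≤ : ∀ {m n} (f : Lin m n) → Inj5 f → m ℕ.≤ n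
inj5⇒≤ {zero}          f inj = ℕ.z≤n
inj5⇒≤ {suc m} {zero}  f inj = ⊥-elim (5∤1 (inj (unit zero) (λ ()) zero))
inj5⇒≤ {suc m} {suc n} f inj with all? (λ i → + 5 ∣? ap f (unit zero) i)
... | yes 5∣f = ⊥-elim (5∤1 (inj (unit zero) 5∣f zero))
... | no ¬5∣f with ¬∀⟶∃¬ (suc n) _ (λ i → + 5 ∣? ap f (unit zero) i) ¬5∣f
... | j , 5∤a = ℕ.s≤s (inj5⇒≤ g inj-g)
  where
  -- Eliminating the j-th coordinate against f (unit zero); the row j is moved to the front first.
  a = ap f (unit zero) j
  f′ = restrict (transpose zero j) ∘ₗ f
  lift : Lin m (suc m)
  lift = ((- + 1) *ₗ (headₗ ∘ₗ f′ ∘ₗ (zeroₗ ⊞ idₗ))) ⊞ (a *ₗ idₗ)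
  g = tailₗ ∘ₗ f′ ∘ₗ lift
  f′-unit : ap f′ (unit zero) zero ≡ a
  f′-unit = cong (ap f (unit zero)) (transpose-left zero j)
  head-g : ∀ x → ap f′ (ap lift x) zero ≡ + 0
  head-g x = trans (ap-cong f′ split zero) (trans (ap-⊕ f′ ((- + 1 * h) ⊙ unit zero) (a ⊙ cons (+ 0) x) zero)
      (trans (cong₂ _+_ (trans (ap-⊙ f′ (- + 1 * h) (unit zero) zero) (cong ((- + 1 * h) *_) f′-unit))
                        (trans (ap-⊙ f′ a (cons (+ 0) x) zero) (cong (a *_) (ap-cong f′ (λ { zero → refl ; (suc i) → refl }) zero))))
        (cancel h a)))
    where
    h = ap f′ (ap (zeroₗ ⊞ idₗ) x) zero
    cancel : ∀ h a → - + 1 * h * a + a * h ≡ + 0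
    cancel = solve-∀
    lem₀ : ∀ b a → b ≡ b * + 1 + a * + 0
    lem₀ = solve-∀
    lem₁ : ∀ b c → c ≡ b * + 0 + c
    lem₁ = solve-∀
    split : ap lift x ≗ (- + 1 * h) ⊙ unit zero ⊕ a ⊙ cons (+ 0) x
    split zero    = lem₀ (- + 1 * h) a
    split (suc i) = lem₁ (- + 1 * h) (a * x i)
  inj-g : Inj5 g
  inj-g x 5∣gx i = euclid5 a 5∤a (inj (ap lift x)
      (iso-∣ᵥ (swapᵢ zero j) (λ { zero → divides (+ 0) (head-g x) ; (suc i) → 5∣gx i })) (suc i))

-- Enumerating and counting sets of indices.

-- A bijection from `Fin r` onto the indices satisfying `A`. It serves both as the list of
-- coordinates to restrict to or extend from, and as the statement that `A` holds for r indices.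
record Selection {n} (A : Fin n → Set) (r : ℕ) : Set where
  field
    index     : Fin r → Fin n
    injective : ∀ {k l} → index k ≡ index l → k ≡ l
    sound     : ∀ k → A (index k)
    complete  : ∀ i → A i → ∃ λ k → index k ≡ i

open Selection public

count : ∀ {n} {A : Fin n → Set} → (∀ i → Dec (A i)) → ℕ
count {n} A? = Σℕ n (λ i → b2ℕ (does (A? i)))

select : ∀ {n} {A : Fin n → Set} (A? : ∀ i → Dec (A i)) → Selection A (count A?)
select {zero} A? = record { index = λ () ; injective = λ { {()} } ; sound = λ () ; complete = λ () }
select {suc n} A? with A? zero | select (A? ∘ suc)
... | yes a | S = record
  { index     = λ { zero → zero ; (suc k) → suc (index S k) }
  ; injective = λ { {zero} {zero} _ → refl ; {suc k} {suc l} eq → cong suc (injective S (suc-injective eq)) }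
  ; sound     = λ { zero → a ; (suc k) → sound S k }
  ; complete  = λ { zero _ → zero , refl
                  ; (suc i) b → let k , eq = complete S i b in suc k , cong suc eq }
  }
... | no ¬a | S = record
  { index     = suc ∘ index S
  ; injective = injective S ∘ suc-injective
  ; sound     = sound S
  ; complete  = λ { zero b → ⊥-elim (¬a b)
                  ; (suc i) b → let k , eq = complete S i b in k , cong suc eq }
  }

selection-⊆ : ∀ {n} {A B : Fin n → Set} {r s} → Selection A r → Selection B s → (∀ i → A i → B i) → r ℕ.≤ s
selection-⊆ S T A⊆B = injective⇒≤ {f = λ k → proj₁ (found k)}
  (λ {k} {l} eq → injective S (trans (sym (proj₂ (found k))) (trans (cong (index T) eq) (proj₂ (found l)))))
  where
  found = λ k → complete T (index S k) (A⊆B _ (sound S k))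

selection-≡ : ∀ {n} {A B : Fin n → Set} {r s} → Selection A r → Selection B s →
  (∀ i → A i → B i) → (∀ i → B i → A i) → r ≡ s
selection-≡ S T A⊆B B⊆A = ℕ.≤-antisym (selection-⊆ S T A⊆B) (selection-⊆ T S B⊆A)

selection-all : ∀ {n} {A : Fin n → Set} → (∀ i → A i) → Selection A n
selection-all a = record { index = λ i → i ; injective = λ eq → eq ; sound = a ; complete = λ i _ → i , refl }

selection-∪ : ∀ {n} {A B : Fin n → Set} {r s} → Selection A r → Selection B s →
  (∀ i → A i → B i → ⊥) → Selection (λ i → A i ⊎ B i) (r ℕ.+ s)
selection-∪ {n} {A} {B} {r} {s} S T disjoint = record
  { index     = λ k → ι (splitAt r k)
  ; injective = λ {k} {l} eq → splitAt-inj k l (ι-inj (splitAt r k) (splitAt r l) eq)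
  ; sound     = λ k → ι-sound (splitAt r k)
  ; complete  = λ { i (inj₁ a) → let k , eq = complete S i a in k ↑ˡ s , trans (cong ι (splitAt-↑ˡ r k s)) eq
                  ; i (inj₂ b) → let k , eq = complete T i b in r ↑ʳ k , trans (cong ι (splitAt-↑ʳ r s k)) eq }
  }
  where
  ι : Fin r ⊎ Fin s → Fin n
  ι = [ index S , index T ]′
  splitAt-inj : ∀ k l → splitAt r {s} k ≡ splitAt r l → k ≡ l
  splitAt-inj k l eq with splitAt r {s} k in eqk | splitAt r {s} l in eql
  splitAt-inj k l refl | inj₁ a | _ = trans (sym (splitAt⁻¹-↑ˡ eqk)) (splitAt⁻¹-↑ˡ eql)
  splitAt-inj k l refl | inj₂ b | _ = trans (sym (splitAt⁻¹-↑ʳ {i = k} eqk)) (splitAt⁻¹-↑ʳ {i = l} eql)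
  ι-inj : ∀ k l → ι k ≡ ι l → k ≡ l
  ι-inj (inj₁ k) (inj₁ l) eq = cong inj₁ (injective S eq)
  ι-inj (inj₁ k) (inj₂ l) eq = ⊥-elim (disjoint _ (sound S k) (subst B (sym eq) (sound T l)))
  ι-inj (inj₂ k) (inj₁ l) eq = ⊥-elim (disjoint _ (sound S l) (subst B eq (sound T k)))
  ι-inj (inj₂ k) (inj₂ l) eq = cong inj₂ (injective T eq)
  ι-sound : ∀ k → A (ι k) ⊎ B (ι k)
  ι-sound (inj₁ k) = inj₁ (sound S k)
  ι-sound (inj₂ k) = inj₂ (sound T k)

module _ {n r} {A : Fin n → Set} (S : Selection A r) where

  extend : Lin r n
  extend = combine (unit ∘ index S)

  extend-index : ∀ x k → ap extend x (index S k) ≡ x k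
  extend-index x k = trans
    (Σ-single r k (λ l l≢k → trans (cong (x l *_) (unit-≢ (l≢k ∘ injective S))) (*-zeroʳ (x l))))
    (trans (cong (x k *_) (unit-≡ (index S k))) (*-identityʳ (x k)))

  extend-outside : ∀ x i → ¬ A i → ap extend x i ≡ + 0
  extend-outside x i ¬a = Σ-zero r (λ k →
    trans (cong (x k *_) (unit-≢ (λ eq → ¬a (subst A eq (sound S k))))) (*-zeroʳ (x k)))

  extend-inj5 : Inj5 extend
  extend-inj5 x 5∣ k = ∣-resp (extend-index x k) (5∣ (index S k))

-- Traces and the use of a diagonalization.

trace : ∀ {n} → Lin n n → ℤ
trace {n} f = Σℤ n (λ i → ap f (unit i) i)

trace-comm : ∀ {n} (f g : Lin n n) → trace (f ∘ₗ g) ≡ trace (g ∘ₗ f)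
trace-comm {n} f g = trans (Σ-cong n (λ i → expand f (ap g (unit i)) i))
  (trans (Σ-swap n n (λ i j → ap g (unit i) j * ap f (unit j) i))
    (Σ-cong n (λ j → trans (Σ-cong n (λ i → *-comm (ap g (unit i) j) (ap f (unit j) i))) (sym (expand g (ap f (unit j)) j)))))

count-sum : ∀ {n} {A : Fin n → Set} (A? : ∀ i → Dec (A i)) c {f : V n} →
  (∀ i → A i → f i ≡ c) → (∀ i → ¬ A i → f i ≡ + 0) → Σℤ n f ≡ c * + count A?
count-sum {zero}  A? c on off = sym (*-zeroʳ c)
count-sum {suc n} A? c {f} on off with A? zero
... | yes a = trans (cong₂ _+_ (on zero a) (count-sum (A? ∘ suc) c (on ∘ suc) (off ∘ suc))) (lem c _)
  where
  lem : ∀ c m → c + c * m ≡ c * (+ 1 + m)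
  lem = solve-∀
... | no ¬a = trans (cong₂ _+_ (off zero ¬a) (count-sum (A? ∘ suc) c (on ∘ suc) (off ∘ suc))) (+-identityˡ _)

module Diagonal {n} {B : Lin n n} (D : Diagonalization B) where
  open Diagonalization D public

  -- The working form P⁻¹ B = diag d · Q⁻¹: divisibility of B x turns into divisibility of each
  -- `d i` times a Q-coordinate of x.
  from-P : ∀ x → ap (from P) (ap B x) ≗ d ⊗ ap (from Q) x
  from-P x i = trans (ap-cong (from P) (λ j → trans (ap-cong B (λ k → sym (to-from Q x k)) j) (diagonal (ap (from Q) x) j)) i)
    (from-to P (d ⊗ ap (from Q) x) i)

  diagonal-unit : ∀ i → ap B (ap (to Q) (unit i)) ≗ d i ⊙ ap (to P) (unit i)
  diagonal-unit i j = trans (diagonal (unit i) j) (trans (ap-cong (to P) scaled j) (ap-⊙ (to P) (d i) (unit i) j))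
    where
    scaled : d ⊗ unit i ≗ d i ⊙ unit i
    scaled j with i ≟ j
    ... | yes refl = refl
    ... | no  i≢j  = trans (*-zeroʳ (d j)) (sym (*-zeroʳ (d i)))

  nonzero? : ∀ i → Dec (d i ≢ + 0)
  nonzero? i = ¬? (d i ≟ℤ + 0)

  -- With W = Q⁻¹P, B² = cB reads diag d · W · diag d = c · diag d, so d i * W i i = c wherever d i ≠ 0.
  trace-idempotent : ∀ c → (∀ x → ap B (ap B x) ≗ c ⊙ ap B x) → trace B ≡ c * + count nonzero?
  trace-idempotent c B²=cB = trans (Σ-cong n (λ i → sym (to-from P (ap B (unit i)) i)))
    (trans (trace-comm (to P) (from P ∘ₗ B)) (count-sum nonzero? c on off))
    where
    W : Fin n → ℤ
    W i = ap (from Q) (ap (to P) (unit i)) i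
    entry : ∀ i → ap (from P) (ap B (ap (to P) (unit i))) i ≡ d i * W i
    entry i = from-P (ap (to P) (unit i)) i
    square : ∀ i → d i * (d i * W i) ≡ d i * c
    square i =
      trans (cong (d i *_) (sym (entry i)))
      (trans (sym (ap-⊙ (from P ∘ₗ B) (d i) (ap (to P) (unit i)) i))
      (trans (ap-cong (from P ∘ₗ B) (λ j → sym (diagonal-unit i j)) i)
      (trans (ap-cong (from P) (λ j → trans (B²=cB (ap (to Q) (unit i)) j) (cong (c *_) (diagonal (unit i) j))) i)
      (trans (ap-⊙ (from P) c (ap (to P) (d ⊗ unit i)) i)
      (trans (cong (c *_) (trans (from-to P (d ⊗ unit i) i) (cong (d i *_) (unit-≡ i))))
        (lem c (d i)))))))
      where
      lem : ∀ c a → c * (a * + 1) ≡ a * c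
      lem = solve-∀
    on : ∀ i → d i ≢ + 0 → ap (from P) (ap B (ap (to P) (unit i))) i ≡ c
    on i d≢0 = trans (entry i) (*-cancelˡ-≡ (d i) _ _ {{≢-nonZero d≢0}} (square i))
    off : ∀ i → ¬ (d i ≢ + 0) → ap (from P) (ap B (ap (to P) (unit i))) i ≡ + 0
    off i ¬d≢0 = trans (entry i) (cong (_* W i) (decidable-stable (d i ≟ℤ + 0) ¬d≢0))

cancel-coprime : ∀ k {a b} → ¬ (+ 5 ∣ b) → + (5 ℕ.^ k) ∣ a * b → + (5 ℕ.^ k) ∣ a
cancel-coprime zero    {a} 5∤b _ = divides a (sym (*-identityʳ a))
cancel-coprime (suc k) {a} {b} 5∤b (divides q eq)
  with cancel-coprime k {a} {b} 5∤b (divides (q * + 5) (trans eq (trans (cong (q *_) (pos-* 5 (5 ℕ.^ k))) (sym (*-assoc q (+ 5) _)))))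
... | divides a′ refl with euclid5 b 5∤b (divides q (*-cancelʳ-≡ (b * a′) (q * + 5) (+ (5 ℕ.^ k)) {{ℕ.m^n≢0 5 k}}
        (trans (lem a′ (+ (5 ℕ.^ k)) b) (trans eq (trans (cong (q *_) (pos-* 5 (5 ℕ.^ k))) (sym (*-assoc q (+ 5) _)))))))
  where
  lem : ∀ a m b → b * a * m ≡ a * m * b
  lem = solve-∀
... | divides a″ refl = divides a″ (trans (*-assoc a″ (+ 5) _) (cong (a″ *_) (sym (pos-* 5 (5 ℕ.^ k)))))

-- Applied with a = `d i`: coordinates at indices where 5^k does not divide `d` vanish modulo 5, so
-- the other coordinates determine the vector modulo 5.
∤-cancel : ∀ k {a b} → ¬ (+ (5 ℕ.^ k) ∣ a) → + (5 ℕ.^ k) ∣ a * b → + 5 ∣ b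
∤-cancel k {a} {b} ∤a ∣ab = decidable-stable (+ 5 ∣? b) (λ 5∤b → ∤a (cancel-coprime k 5∤b ∣ab))

Σ-const : ∀ n a → Σℤ n (λ _ → a) ≡ + n * a
Σ-const zero    a = sym (*-zeroˡ a)
Σ-const (suc n) a = trans (cong (_+_ a) (Σ-const n a)) (lem a (+ n))
  where
  lem : ∀ a m → a + m * a ≡ (+ 1 + m) * a
  lem = solve-∀

total-unit : ∀ {n} (i : Fin n) → total (unit i) ≡ + 1
total-unit {n} i = trans (Σ-single n i (λ j j≢i → unit-≢ (j≢i ∘ sym))) (unit-≡ i)

constant : ∀ {n} (x : V n) a → Σℤ n (λ k → x k * a) ≡ total x * a
constant {n} x a = trans (Σ-cong n (λ k → *-comm (x k) a)) (trans (Σ-* n a x) (*-comm a (total x)))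

-- Linear algebra of the Laplacian: eigenspaces and kernels.

-- All that the linear algebra retains of the graph. The base vertex `o` picks one column of L and
-- names a constant vector by one coordinate.
record MooreOperator {n} (Mat : Fin n → Fin n → ℤ) : Set where
  field
    L          : Lin n n
    L-unit     : ∀ k i → ap L (unit k) i ≡ Mat i k
    L²         : ∀ x i → ap L (ap L x) i ≡ total x + + 115 * ap L x i - + 3250 * x i
    L1         : ap L 1v ≗ 0v
    ΣL         : ∀ x → total (ap L x) ≡ + 0
    L-diagonal : ∀ i → ap L (unit i) i ≡ + 57
    o          : Fin n
    n≡3250     : n ≡ 3250

module Moore {n} {Mat : Fin n → Fin n → ℤ} (MO : MooreOperator Mat) where
  open MooreOperator MO

  -- Independence over the rationals would be too weak: integral eigenvectors can become dependent
  -- modulo 5, and the counts take place over F_5.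
  Eigenspace : ℤ → ℕ → Set
  Eigenspace c m = ∃ λ (h : Lin m n) → Inj5 h × (∀ x → ap L (ap h x) ≗ c ⊙ ap h x)

  -- With c′ = 115 - c the other eigenvalue, `root` says c c′ = 3250. Then B = J + c (L - c′) is c
  -- (c - c′) times the projection onto the c-eigenspace; the summand J makes it kill the all-ones
  -- vector too. So the trace of B yields the multiplicity.
  module Eigen (c : ℤ) (root : + 115 * c - + 3250 ≡ c * c) where

    B : Lin n n
    B = (combine (λ _ → 1v) +ₗ c *ₗ L) +ₗ (- + 3250) *ₗ idₗ

    B-eq : ∀ x i → ap B x i ≡ total x + c * ap L x i - + 3250 * x i
    B-eq x i = trans (cong (λ s → s + c * ap L x i + - + 3250 * x i) (constant x (+ 1))) (lem (total x) _ (x i))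
      where
      lem : ∀ s l a → s * + 1 + l + - + 3250 * a ≡ s + l - + 3250 * a
      lem = solve-∀

    LB : ∀ x i → ap L (ap B x) i ≡ c * ap B x i
    LB x i = trans (ap-cong L (λ j → trans (B-eq x j) (shape (total x) c (ap L x j) (x j))) i)
      (trans (ap-⊕ L (total x ⊙ 1v ⊕ c ⊙ ap L x) ((- + 3250) ⊙ x) i)
      (trans (cong₂ _+_ (trans (ap-⊕ L (total x ⊙ 1v) (c ⊙ ap L x) i)
                (cong₂ _+_ (trans (ap-⊙ L (total x) 1v i) (cong (total x *_) (L1 i)))
                           (trans (ap-⊙ L c (ap L x) i) (cong (c *_) (L² x i)))))
              (ap-⊙ L (- + 3250) x i))
      (trans (lem₁ (total x) c (ap L x i) (x i))
      (trans (cong (λ r → c * total x + r * ap L x i - c * + 3250 * x i) root)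
      (trans (lem₂ (total x) c (ap L x i) (x i)) (cong (c *_) (sym (B-eq x i))))))))
      where
      shape : ∀ s c l a → s + c * l - + 3250 * a ≡ s * + 1 + c * l + - + 3250 * a
      shape = solve-∀
      lem₁ : ∀ s c l a → s * + 0 + c * (s + + 115 * l - + 3250 * a) + - + 3250 * l
                         ≡ c * s + (+ 115 * c - + 3250) * l - c * + 3250 * a
      lem₁ = solve-∀
      lem₂ : ∀ s c l a → c * s + c * c * l - c * + 3250 * a ≡ c * (s + c * l - + 3250 * a)
      lem₂ = solve-∀

    total-B : ∀ x → total (ap B x) ≡ + 0
    total-B x = trans (Σ-cong n (B-eq x))
      (trans (Σ-cong n (λ i → shape (total x) (c * ap L x i) (x i)))
      (trans (Σ-+ n (λ i → total x + c * ap L x i) (λ i → - + 3250 * x i))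
      (trans (cong₂ _+_ (trans (Σ-+ n (λ _ → total x) (λ i → c * ap L x i))
                (cong₂ _+_ (trans (Σ-const n (total x)) (cong (λ m → + m * total x) n≡3250))
                           (trans (Σ-* n c (ap L x)) (cong (c *_) (ΣL x)))))
              (Σ-* n (- + 3250) x))
        (lem (total x) c))))
      where
      shape : ∀ s l a → s + l - + 3250 * a ≡ s + l + - + 3250 * a
      shape = solve-∀
      lem : ∀ s c → + 3250 * s + c * + 0 + - + 3250 * s ≡ + 0
      lem = solve-∀

    B² : ∀ x i → ap B (ap B x) i ≡ (c * c - + 3250) * ap B x i
    B² x i = trans (B-eq (ap B x) i)
      (trans (cong₂ (λ s l → s + c * l - + 3250 * ap B x i) (total-B x) (LB x i)) (lem c (ap B x i)))
      where
      lem : ∀ c b → + 0 + c * (c * b) - + 3250 * b ≡ (c * c - + 3250) * b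
      lem = solve-∀

    trace-B : trace B ≡ + 3250 * (+ 1 + c * + 57 - + 3250)
    trace-B = trans (Σ-cong n (λ i → trans (B-eq (unit i) i)
        (trans (cong (λ u → total (unit i) + c * ap L (unit i) i - + 3250 * u) (unit-≡ i))
               (cong₂ (λ s l → s + c * l - + 3250) (total-unit i) (L-diagonal i)))))
      (trans (Σ-const n (+ 1 + c * + 57 - + 3250)) (cong (λ m → + m * (+ 1 + c * + 57 - + 3250)) n≡3250))

    open Diagonal (diagonalize B)

    multiplicity : ℕ
    multiplicity = count nonzero?

    multiplicity-eq : (c * c - + 3250) * + multiplicity ≡ + 3250 * (+ 1 + c * + 57 - + 3250)
    multiplicity-eq = trans (sym (trace-idempotent (c * c - + 3250) B²)) trace-B

    private
      S : Selection (λ i → d i ≢ + 0) multiplicity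
      S = select nonzero?

      vector : Fin multiplicity → V n
      vector k = ap (to P) (unit (index S k))

    -- B Q eᵢ = dᵢ P eᵢ, so for dᵢ ≠ 0 cancelling dᵢ shows that P eᵢ is itself an eigenvector.
    -- Columns of the unimodular P stay independent modulo 5, which columns of B may fail to do.
    eigenvectors : Lin multiplicity n
    eigenvectors = combine vector

    eigenvectors-inj5 : Inj5 eigenvectors
    eigenvectors-inj5 x 5∣ = extend-inj5 S x
      (iso-∣ᵥ P (λ i → ∣-resp (sym (combine-image (to P) (unit ∘ index S) x i)) (5∣ i)))

    private
      L-vector : ∀ k → ap L (vector k) ≗ c ⊙ vector k
      L-vector k j = *-cancelˡ-≡ (d i) _ _ {{≢-nonZero (sound S k)}}
        (trans (sym (ap-⊙ L (d i) (vector k) j))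
        (trans (ap-cong L (λ l → sym (diagonal-unit i l)) j)
        (trans (LB (ap (to Q) (unit i)) j)
        (trans (cong (c *_) (diagonal-unit i j)) (x∙yz≈y∙xz c (d i) (vector k j))))))
        where
        i = index S k

    L-eigenvectors : ∀ x → ap L (ap eigenvectors x) ≗ c ⊙ ap eigenvectors x
    L-eigenvectors x i = trans (combine-image L vector x i)
      (trans (Σ-cong multiplicity (λ k → trans (cong (x k *_) (L-vector k i)) (x∙yz≈y∙xz (x k) c (vector k i))))
        (Σ-* multiplicity c (λ k → x k * vector k i)))

    eigenspace : Eigenspace c multiplicity
    eigenspace = eigenvectors , eigenvectors-inj5 , L-eigenvectors

  abstract
    eigenspace50 : Eigenspace (+ 50) 1729
    -- -750 = 50² - 3250, and 3250 · (1 + 50·57 - 3250) = -750 · 1729.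
    eigenspace50 = subst (Eigenspace (+ 50)) (+-injective (*-cancelˡ-≡ (- + 750) _ _ multiplicity-eq)) eigenspace
      where
      open Eigen (+ 50) refl

    eigenspace65 : Eigenspace (+ 65) 1520
    -- 975 = 65² - 3250, and 3250 · (1 + 65·57 - 3250) = 975 · 1520.
    eigenspace65 = subst (Eigenspace (+ 65)) (+-injective (*-cancelˡ-≡ (+ 975) _ _ multiplicity-eq)) eigenspace
      where
      open Eigen (+ 65) refl

  u : V n
  u = ap L (unit o)

  L-u : ∀ i → ap L u i ≡ + 1 + + 115 * u i - + 3250 * unit o i
  L-u i = trans (L² (unit o) i) (cong (λ s → s + + 115 * u i - + 3250 * unit o i) (total-unit o))

  -- The complementary factor in L (L - 115) = J - 3250: on vectors of sum 0 it inverts L up to the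
  -- factor -3250, and it agrees with L modulo 5.
  M : Lin n n
  M = L +ₗ (- + 115) *ₗ idₗ

  LM : ∀ x i → ap L (ap M x) i ≡ total x - + 3250 * x i
  LM x i = trans (ap-⊕ L (ap L x) ((- + 115) ⊙ x) i)
    (trans (cong₂ _+_ (L² x i) (ap-⊙ L (- + 115) x i)) (lem (total x) (ap L x i) (x i)))
    where
    lem : ∀ s l a → s + + 115 * l - + 3250 * a + - + 115 * l ≡ s - + 3250 * a
    lem = solve-∀

  -- Applying L once more gives 0 = `total x` - 3250 xᵢ, which fixes every coordinate.
  kernel-constant : ∀ x → ap L x ≗ 0v → ∀ i → x i ≡ x o
  kernel-constant x Lx≡0 i = *-cancelˡ-≡ (+ 3250) _ _ (trans (eq i) (sym (eq o)))
    where
    lem : ∀ s a → s ≡ (s + + 115 * + 0 - + 3250 * a) + + 3250 * a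
    lem = solve-∀
    eq : ∀ i → + 3250 * x i ≡ total x
    eq i = sym (trans (lem (total x) (x i)) (trans (cong (_+ + 3250 * x i)
      (trans (cong (λ l → total x + + 115 * l - + 3250 * x i) (sym (Lx≡0 i)))
        (trans (sym (L² x i)) (trans (ap-cong L Lx≡0 i) (ap-0 L i))))) (+-identityˡ _)))

  -- L u ≡ 1v modulo 5, so u is independent of everything that L kills modulo 5.
  u-independent : ∀ t v → + 5 ∣ᵥ t ⊙ u ⊕ v → + 5 ∣ᵥ ap L v → + 5 ∣ t × + 5 ∣ᵥ v
  u-independent t v 5∣ 5∣Lv = 5∣t , λ i → ∣m+n∣m⇒∣n (5∣ i) (∣m⇒∣m*n (u i) 5∣t)
    where
    lem : ∀ t l a → t * (+ 1 + + 115 * l - + 3250 * a) ≡ t + (t * (+ 23 * l - + 650 * a)) * + 5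
    lem = solve-∀
    5∣tLu : + 5 ∣ t * ap L u o
    5∣tLu = ∣m+n∣n⇒∣m (∣-resp (trans (ap-⊕ L (t ⊙ u) v o) (cong (_+ ap L v o) (ap-⊙ L t u o))) (∣ᵥ-ap L 5∣ o)) (5∣Lv o)
    5∣t : + 5 ∣ t
    5∣t = ∣m+n∣n⇒∣m (∣-resp (trans (cong (t *_) (L-u o)) (lem t (u o) (unit o o))) 5∣tLu) (divides (t * (+ 23 * u o - + 650 * unit o o)) refl)

  -- If L k = 125 z then L (26 k + (L - 115) z) = 0, so 26 k + (L - 115) z is constant,
  -- and constants are in the image of L modulo 5.
  kernel125⊆image : ∀ k → + 125 ∣ᵥ ap L k → ∃ λ (w : V n) → ∃ λ (v : V n) → ∀ i → + 26 * k i ≡ ap L w i + + 5 * v i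
  kernel125⊆image k 125∣Lk = w , v , λ i →
    trans (lem₁ (+ 26 * k i) (ap L z i) (z i))
    (trans (cong (λ s → s - (ap L z i + - + 115 * z i)) (kernel-constant y Ly≡0 i))
    (trans (lem₂ c (unit o i) (ap L z i) (z i))
      (cong (λ s → s + + 5 * v i) (sym (L-w i)))))
    where
    z : V n
    z i = _∣_.quotient (125∣Lk i)
    Lk≡ : ∀ i → ap L k i ≡ + 125 * z i
    Lk≡ i = trans (_∣_.equality (125∣Lk i)) (*-comm (z i) (+ 125))
    total-z : total z ≡ + 0
    total-z = *-cancelˡ-≡ (+ 125) _ _ (trans (sym (Σ-* n (+ 125) z)) (trans (sym (Σ-cong n Lk≡)) (ΣL k)))
    y : V n
    y = + 26 ⊙ k ⊕ ap M z
    c : ℤ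
    c = y o
    w v : V n
    w = c ⊙ ap M (unit o) ⊕ (- + 1) ⊙ z
    v i = c * (+ 650 * unit o i) + + 23 * z i
    L-w : ∀ i → ap L w i ≡ c * (+ 1 - + 3250 * unit o i) + - + 1 * ap L z i
    L-w i = trans (ap-⊕ L (c ⊙ ap M (unit o)) ((- + 1) ⊙ z) i)
      (cong₂ _+_ (trans (ap-⊙ L c (ap M (unit o)) i)
                   (cong (c *_) (trans (LM (unit o) i) (cong (λ s → s - + 3250 * unit o i) (total-unit o)))))
        (ap-⊙ L (- + 1) z i))
    Ly≡0 : ap L y ≗ 0v
    Ly≡0 i = trans (ap-⊕ L (+ 26 ⊙ k) (ap M z) i)
      (trans (cong₂ _+_ (trans (ap-⊙ L (+ 26) k i) (cong (+ 26 *_) (Lk≡ i))) (trans (LM z i) (cong (λ s → s - + 3250 * z i) total-z)))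
        (lem (z i)))
      where
      lem : ∀ a → + 26 * (+ 125 * a) + (+ 0 - + 3250 * a) ≡ + 0
      lem = solve-∀
    lem₁ : ∀ a l z → a ≡ a + (l + - + 115 * z) - (l + - + 115 * z)
    lem₁ = solve-∀
    lem₂ : ∀ c e l z → c - (l + - + 115 * z) ≡ c * (+ 1 - + 3250 * e) + - + 1 * l + + 5 * (c * (+ 650 * e) + + 23 * z)
    lem₂ = solve-∀

  -- Bounds on the number of diagonal entries of each kind.

  module _ (D : Diagonalization L) where
    open Diagonal D

    from-P-∣ : ∀ {k} x i → k ∣ᵥ ap L x → k ∣ d i * ap (from Q) x i
    from-P-∣ x i k∣ = ∣-resp (from-P x i) (∣ᵥ-ap (from P) k∣ i)

    -- 25 divides 50, hence L of an eigenvector, so its Q-coordinates vanish modulo 5 wherever 25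
    -- does not divide `d`; those in `S` detect it.
    eigenspace50≤ : ∀ {e r} → Eigenspace (+ 50) e → Selection (λ i → + 25 ∣ d i) r → e ℕ.≤ r
    eigenspace50≤ (h , h-inj5 , Lh) S = inj5⇒≤ (restrict (index S) ∘ₗ from Q ∘ₗ h) inj
      where
      inj : Inj5 (restrict (index S) ∘ₗ from Q ∘ₗ h)
      inj x 5∣ = h-inj5 x (iso-∣ᵥ (flipᵢ Q) 5∣y)
        where
        y = ap (from Q) (ap h x)
        lem : ∀ a → + 50 * a ≡ + 2 * a * + 25
        lem = solve-∀
        5∣y : + 5 ∣ᵥ y
        5∣y i = case + 25 ∣? d i of λ
          { (yes 25∣d) → let k , eq = complete S i 25∣d in ∣-resp (cong y eq) (5∣ k)
          ; (no 25∤d) → ∤-cancel 2 25∤d (from-P-∣ (ap h x) i (λ j →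
                divides (+ 2 * ap h x j) (trans (Lh x j) (lem (ap h x j)))))
          }

    -- The inequality is strict because `u` is adjoined to the eigenvectors: L kills these modulo 5,
    -- so `u` is independent of them.
    eigenspace65< : ∀ {e r} → Eigenspace (+ 65) e → Selection (λ i → ¬ (+ 25 ∣ d i)) r → e ℕ.< r
    eigenspace65< {e} (h , h-inj5 , Lh) S = inj5⇒≤ (restrict (index S) ∘ₗ from P ∘ₗ H) inj
      where
      H : Lin (suc e) n
      H = (combine (λ _ → u) ∘ₗ headₗ) +ₗ (h ∘ₗ tailₗ)
      inj : Inj5 (restrict (index S) ∘ₗ from P ∘ₗ H)
      inj x 5∣ = λ { zero → proj₁ split ; (suc i) → h-inj5 (x ∘ suc) (proj₂ split) i }
        where
        t = x zero
        v = ap h (x ∘ suc)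
        y = ap (from P) (ap H x)
        -- Chosen so that L w = 65 (t u + v). In P-coordinates 65 yᵢ is then a multiple of dᵢ, and
        -- 25 ∣ dᵢ leaves 5 ∣ 13 yᵢ.
        w = (+ 65 * t) ⊙ unit o ⊕ v
        Lw : ∀ i → ap L w i ≡ + 65 * ap H x i
        Lw i = trans (ap-⊕ L ((+ 65 * t) ⊙ unit o) v i)
          (trans (cong₂ _+_ (ap-⊙ L (+ 65 * t) (unit o) i) (Lh (x ∘ suc) i)) (lem t (u i) (v i)))
          where
          lem : ∀ t u v → + 65 * t * u + + 65 * v ≡ + 65 * (t * u + + 0 + v)
          lem = solve-∀
        5∣y : + 5 ∣ᵥ y
        5∣y i = case + 25 ∣? d i of λ
          { (no 25∤d) → let k , eq = complete S i 25∤d in ∣-resp (cong y eq) (5∣ k)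
          ; (yes (divides q eq)) → euclid5 (+ 13) (from-no (+ 5 ∣? + 13)) (divides (q * ap (from Q) w i) (*-cancelˡ-≡ (+ 5) _ _
                (trans (lem₁ (y i)) (trans (sym (trans (ap-cong (from P) Lw i) (ap-⊙ (from P) (+ 65) (ap H x) i)))
                  (trans (from-P w i) (trans (cong (_* ap (from Q) w i) eq) (lem₂ q _)))))))
          }
          where
          lem₁ : ∀ y → + 5 * (+ 13 * y) ≡ + 65 * y
          lem₁ = solve-∀
          lem₂ : ∀ q z → q * + 25 * z ≡ + 5 * (q * z * + 5)
          lem₂ = solve-∀
        split = u-independent t v
          (λ i → ∣-resp (cong (_+ v i) (+-identityʳ (t * u i))) (iso-∣ᵥ (flipᵢ P) {ap H x} 5∣y i))
          (λ i → divides (+ 13 * v i) (trans (Lh (x ∘ suc) i) (lem (v i))))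
          where
          lem : ∀ a → + 65 * a ≡ + 13 * a * + 5
          lem = solve-∀

    -- L M = -26·125 on vectors of sum 0, so 125 divides L of their images under M, and modulo 5
    -- these images have only r free Q-coordinates. As M ≡ L, this bounds the rank of L on vectors
    -- of sum 0; the extra 1 is the coordinate sum.
    rank≤ : ∀ {e r} (h : Lin e n) → Inj5 (L ∘ₗ h) → Selection (λ i → + 125 ∣ d i) r → e ℕ.≤ suc r
    rank≤ {e} {r} h indep S = inj5⇒≤ F inj
      where
      -- The projection onto vectors of sum 0 along `unit o`.
      Y : Lin n n
      Y = idₗ +ₗ combine (λ _ → (- + 1) ⊙ unit o)
      Y-eq : ∀ x i → ap Y x i ≡ x i + total x * (- + 1 * unit o i)
      Y-eq x i = cong (_+_ (x i)) (constant x (- + 1 * unit o i))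
      total-Y : ∀ x → total (ap Y x) ≡ + 0
      total-Y x = trans (Σ-cong n (Y-eq x)) (trans (Σ-+ n x (λ i → total x * (- + 1 * unit o i)))
        (trans (cong (_+_ (total x)) (trans (Σ-* n (total x) ((- + 1) ⊙ unit o)) (cong (total x *_)
          (trans (Σ-* n (- + 1) (unit o)) (cong (- + 1 *_) (total-unit o)))))) (lem (total x))))
        where
        lem : ∀ a → a + a * (- + 1 * + 1) ≡ + 0
        lem = solve-∀
      F : Lin e (suc r)
      F = (sumₗ ∘ₗ h) ⊞ (restrict (index S) ∘ₗ from Q ∘ₗ M ∘ₗ Y ∘ₗ h)
      inj : Inj5 F
      inj x 5∣ = indep x (λ i → ∣-resp (trans (sym (ap-⊕ L y (total (ap h x) ⊙ unit o) i)) (ap-cong L (λ j → sym (h≡ j)) i))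
          (∣m∣n⇒∣m+n (∣-resp (lem₂ (ap L y i) (y i)) (∣m∣n⇒∣m+n (5∣My i) (divides (+ 23 * y i) refl)))
            (∣ᵥ-ap L (λ j → ∣m⇒∣m*n (unit o j) 5∣total) i)))
        where
        y = ap Y (ap h x)
        z = ap (from Q) (ap M y)
        5∣total : + 5 ∣ total (ap h x)
        5∣total = ∣-resp (sumₗ-total (ap h x) zero) (5∣ zero)
        lem₀ : ∀ a → + 0 - + 3250 * a ≡ - + 26 * a * + 125
        lem₀ = solve-∀
        lem₁ : ∀ a t e → a ≡ a + t * (- + 1 * e) + t * e
        lem₁ = solve-∀
        lem₂ : ∀ l a → l + - + 115 * a + + 23 * a * + 5 ≡ l
        lem₂ = solve-∀
        h≡ : ∀ j → ap h x j ≡ y j + total (ap h x) * unit o j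
        h≡ j = trans (lem₁ (ap h x j) (total (ap h x)) (unit o j)) (cong (_+ total (ap h x) * unit o j) (sym (Y-eq (ap h x) j)))
        5∣z : + 5 ∣ᵥ z
        5∣z i = case + 125 ∣? d i of λ
          { (yes 125∣d) → let k , eq = complete S i 125∣d in ∣-resp (cong z eq) (5∣ (suc k))
          ; (no 125∤d) → ∤-cancel 3 125∤d (from-P-∣ (ap M y) i (λ j → divides (- + 26 * y j)
                (trans (LM y j) (trans (cong (λ s → s - + 3250 * y j) (total-Y (ap h x))) (lem₀ (y j))))))
          }
        5∣My : + 5 ∣ᵥ ap M y
        5∣My = iso-∣ᵥ (flipᵢ Q) 5∣z

    -- The r columns of Q with 125 ∣ d lie modulo 5 in the image of L, and so does `u`, which is
    -- independent of them because L kills them modulo 5. Vectors in that image have P-coordinates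
    -- divisible by 5 outside the s indices of `T`.
    kernel125< : ∀ {r s} → Selection (λ i → + 125 ∣ d i) r → Selection (λ i → ¬ (+ 5 ∣ d i)) s → suc r ℕ.≤ s
    kernel125< {r} {s} S T = inj5⇒≤ (restrict (index T) ∘ₗ from P ∘ₗ H) inj
      where
      H : Lin (suc r) n
      H = (combine (λ _ → u) ∘ₗ headₗ) +ₗ (to Q ∘ₗ extend S ∘ₗ tailₗ)
      inj : Inj5 (restrict (index T) ∘ₗ from P ∘ₗ H)
      inj x 5∣ = λ { zero → proj₁ split ; (suc i) → extend-inj5 S (x ∘ suc) (iso-∣ᵥ Q (proj₂ split)) i }
        where
        t = x zero
        k = ap (to Q) (ap (extend S) (x ∘ suc))
        y = ap (from P) (ap H x)
        125∣d⊗ : + 125 ∣ᵥ d ⊗ ap (extend S) (x ∘ suc)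
        125∣d⊗ i = case + 125 ∣? d i of λ
          { (yes 125∣d) → ∣m⇒∣m*n _ 125∣d
          ; (no 125∤d) → divides (+ 0) (trans (cong (d i *_) (extend-outside S (x ∘ suc) i 125∤d)) (*-zeroʳ (d i)))
          }
        125∣Lk : + 125 ∣ᵥ ap L k
        125∣Lk i = ∣-resp (sym (diagonal (ap (extend S) (x ∘ suc)) i)) (∣ᵥ-ap (to P) 125∣d⊗ i)
        w = proj₁ (kernel125⊆image k 125∣Lk)
        v = proj₁ (proj₂ (kernel125⊆image k 125∣Lk))
        26k≡ : ∀ i → + 26 * k i ≡ ap L w i + + 5 * v i
        26k≡ = proj₂ (proj₂ (kernel125⊆image k 125∣Lk))
        w′ = (+ 26 * t) ⊙ unit o ⊕ w
        26H≡ : ∀ i → + 26 * ap H x i ≡ ap L w′ i + + 5 * v i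
        26H≡ i = trans (lem₁ t (u i) (k i)) (trans (cong (_+_ (+ 26 * t * u i)) (26k≡ i)) (trans (sym (+-assoc (+ 26 * t * u i) (ap L w i) (+ 5 * v i)))
          (cong (_+ + 5 * v i) (sym (trans (ap-⊕ L ((+ 26 * t) ⊙ unit o) w i) (cong (_+ ap L w i) (ap-⊙ L (+ 26 * t) (unit o) i)))))))
          where
          lem₁ : ∀ t u k → + 26 * (t * u + + 0 + k) ≡ + 26 * t * u + + 26 * k
          lem₁ = solve-∀
        5∣y : + 5 ∣ᵥ y
        5∣y i = case + 5 ∣? d i of λ
          { (no 5∤d) → let k , eq = complete T i 5∤d in ∣-resp (cong y eq) (5∣ k)
          ; (yes 5∣d) → euclid5 (+ 26) (from-no (+ 5 ∣? + 26)) (∣-resp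
                (sym (trans (sym (ap-⊙ (from P) (+ 26) (ap H x) i)) (trans (ap-cong (from P) 26H≡ i)
                  (trans (ap-⊕ (from P) (ap L w′) (+ 5 ⊙ v) i) (cong₂ _+_ (from-P w′ i) (ap-⊙ (from P) (+ 5) v i))))))
                (∣m∣n⇒∣m+n (∣m⇒∣m*n _ 5∣d) (divides (ap (from P) v i) (*-comm (+ 5) _))))
          }
        split = u-independent t k
          (λ i → ∣-resp (cong (_+ k i) (+-identityʳ (t * u i))) (iso-∣ᵥ (flipᵢ P) {ap H x} 5∣y i))
          (λ i → case 125∣Lk i of λ { (divides q eq) → divides (q * + 25) (trans eq (sym (*-assoc q (+ 25) (+ 5)))) })

    -- `b` expresses L y through the chosen vectors modulo 5, so `b` y ≡ 0 forces L y ≡ 0; for y in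
    -- the span of the columns of Q with 5 ∤ d this means y ≡ 0.
    ≤rank : ∀ {e r} (h : Lin e n) (b : Lin n e) → (∀ x i → + 5 ∣ ap L x i - ap L (ap h (ap b x)) i) →
      Selection (λ i → ¬ (+ 5 ∣ d i)) r → r ℕ.≤ e
    ≤rank h b span S = inj5⇒≤ (b ∘ₗ to Q ∘ₗ extend S) inj
      where
      inj : Inj5 (b ∘ₗ to Q ∘ₗ extend S)
      inj x 5∣ k = euclid5 (d (index S k)) (sound S k)
        (∣-resp (cong (d (index S k) *_) (extend-index S x k))
          (iso-∣ᵥ P (λ i → ∣-resp (diagonal (ap (extend S) x) i) (5∣LQx i)) (index S k)))
        where
        y = ap (to Q) (ap (extend S) x)
        lem : ∀ a b → a - b + b ≡ a
        lem = solve-∀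
        5∣LQx : + 5 ∣ᵥ ap L y
        5∣LQx i = ∣-resp (lem _ _) (∣m∣n⇒∣m+n (span y i) (∣ᵥ-ap (L ∘ₗ h) 5∣ i))

    -- Columns of Q with d = 0 span kernel vectors, which are constant and so determined by the
    -- coordinate at `o`. If no entry were 0, L would be injective, against L 1 = 0.
    corank≡1 : ∀ {r} → Selection (λ i → d i ≡ + 0) r → r ≡ 1
    corank≡1 {r} S = ℕ.≤-antisym (inj5⇒≤ (restrict (λ _ → o) ∘ₗ to Q ∘ₗ extend S) inj) nonempty
      where
      inj : Inj5 (restrict (λ _ → o) ∘ₗ to Q ∘ₗ extend S)
      inj x 5∣ = extend-inj5 S x (iso-∣ᵥ Q (λ i → ∣-resp (sym (kernel-constant y Ly≡0 i)) (5∣ zero)))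
        where
        y = ap (to Q) (ap (extend S) x)
        vanish : d ⊗ ap (extend S) x ≗ 0v
        vanish i = case d i ≟ℤ + 0 of λ
          { (yes d≡0) → cong (_* _) d≡0
          ; (no d≢0) → trans (cong (d i *_) (extend-outside S x i d≢0)) (*-zeroʳ (d i))
          }
        Ly≡0 : ap L y ≗ 0v
        Ly≡0 i = trans (diagonal (ap (extend S) x) i) (trans (ap-cong (to P) vanish i) (ap-0 (to P) i))
      nonempty : 1 ℕ.≤ r
      nonempty with any? (λ i → d i ≟ℤ + 0)
      ... | yes (i , d≡0) with complete S i d≡0
      ...   | zero  , _ = ℕ.s≤s ℕ.z≤n
      ...   | suc _ , _ = ℕ.s≤s ℕ.z≤n
      nonempty | no ¬∃ = ⊥-elim (5∤1 (∣-resp 0≡1 (divides (+ 0) refl)))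
        where
        z = ap (from Q) 1v
        z≡0 : z ≗ 0v
        z≡0 i = *-cancelˡ-≡ (d i) _ _ {{≢-nonZero (λ d≡0 → ¬∃ (i , d≡0))}}
          (trans (sym (from-P 1v i)) (trans (ap-cong (from P) L1 i) (trans (ap-0 (from P) i) (sym (*-zeroʳ (d i))))))
        0≡1 : + 0 ≡ + 1
        0≡1 = trans (sym (ap-0 (to Q) o)) (trans (ap-cong (to Q) (λ j → sym (z≡0 j)) o) (to-from Q 1v o))

    -- As d i ≠ 0 and d i · p is an image under L, the column p of P has sum 0. Hence L M p = -3250
    -- p, whose i-th P-coordinate exhibits -3250 as a multiple of `d i`.
    d∣3250 : ∀ i → d i ≢ + 0 → d i ∣ + 3250
    d∣3250 i d≢0 = divides (- + 1 * ap (from Q) (ap M p) i)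
      (trans (lem₂ (+ 3250)) (trans (cong (λ e → - + 1 * (- + 3250 * e)) (sym (unit-≡ i)))
      (trans (cong (- + 1 *_) (trans (sym eq) (from-P (ap M p) i))) (lem₁ (d i) _))))
      where
      p = ap (to P) (unit i)
      total-p : total p ≡ + 0
      total-p = *-cancelˡ-≡ (d i) _ _ {{≢-nonZero d≢0}} (trans (sym (Σ-* n (d i) p))
        (trans (sym (Σ-cong n (diagonal-unit i))) (trans (ΣL (ap (to Q) (unit i))) (sym (*-zeroʳ (d i))))))
      lem : ∀ a → + 0 - + 3250 * a ≡ - + 3250 * a
      lem = solve-∀
      lem₁ : ∀ d a → - + 1 * (d * a) ≡ - + 1 * a * d
      lem₁ = solve-∀
      lem₂ : ∀ a → a ≡ - + 1 * (- a * + 1)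
      lem₂ = solve-∀
      eq : ap (from P) (ap L (ap M p)) i ≡ - + 3250 * unit i i
      eq = trans (ap-cong (from P) (λ j → trans (LM p j) (trans (cong (λ s → s - + 3250 * p j) total-p) (lem (p j)))) i)
        (trans (ap-⊙ (from P) (- + 3250) p i) (cong (- + 3250 *_) (from-to P (unit i) i)))

-- The Sylow 5-subgroup of the cokernel of a diagonalized map.

ap-- : ∀ {m n} (f : Lin m n) x y i → ap f x i - ap f y i ≡ ap f (λ k → x k - y k) i
ap-- f x y i = trans (lem (ap f x i) (ap f y i)) (trans (cong (_+_ (ap f x i)) (sym (ap-⊙ f (- + 1) y i)))
  (trans (sym (ap-⊕ f x ((- + 1) ⊙ y) i)) (ap-cong f (λ k → sym (lem (x k) (y k))) i)))
  where
  lem : ∀ a b → a - b ≡ a + - + 1 * b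
  lem = solve-∀

cancel-power : ∀ k {w y} → ¬ (+ 5 ∣ w) → w ∣ + (5 ℕ.^ k) * y → w ∣ y
cancel-power zero    {w} {y} 5∤w w∣ = ∣-resp (*-identityˡ y) w∣
cancel-power (suc k) {w} {y} 5∤w w∣ = cancel-power k 5∤w (step (∣-resp (trans (cong (_* y) (pos-* 5 (5 ℕ.^ k))) (*-assoc (+ 5) (+ (5 ℕ.^ k)) y)) w∣))
  where
  lem₂ : ∀ q w → q * + 5 * w ≡ + 5 * (q * w)
  lem₂ = solve-∀
  step : ∀ {y} → w ∣ + 5 * y → w ∣ y
  step {y} (divides q eq) with euclid5 w {q} 5∤w (divides y (trans (*-comm w q) (trans (sym eq) (*-comm (+ 5) y))))
  ... | divides q′ refl = divides q′ (*-cancelˡ-≡ (+ 5) y (q′ * w) (trans eq (lem₂ q′ w)))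

module Cokernel {n} (Mat : Fin n → Fin n → ℤ) (L : Lin n n) (L≗ : ∀ x → ap L x ≗ Mat ·v x) (D : Diagonalization L) where
  open Diagonal D

  image-diagonal : ∀ {y} → (∀ i → d i ∣ ap (from P) y i) → InImage Mat y
  image-diagonal {y} d∣ = ap (to Q) z , λ i → trans (sym (L≗ (ap (to Q) z) i)) (trans (diagonal z i)
    (trans (ap-cong (to P) (λ j → trans (*-comm (d j) (z j)) (sym (_∣_.equality (d∣ j)))) i) (to-from P y i)))
    where
    z : V n
    z i = _∣_.quotient (d∣ i)

  diagonal-image : ∀ {y} → InImage Mat y → ∀ i → d i ∣ ap (from P) y i
  diagonal-image {y} (z , eq) i = divides (ap (from Q) z i)
    (trans (ap-cong (from P) (λ j → trans (sym (eq j)) (sym (L≗ z j))) i) (trans (from-P z i) (*-comm (d i) _)))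

  -- Indices outside `A` add nothing to the 5-part: d = 0 gives a free summand, 5 ∤ d a finite one
  -- of order prime to 5.
  module _ {r} {A : Fin n → Set} (S : Selection A r) (ms : Fin r → ℕ) (w : V r)
    (classify : ∀ i → A i ⊎ (¬ A i × (d i ≡ + 0 ⊎ ¬ (+ 5 ∣ d i))))
    (factor : ∀ k → d (index S k) ≡ + ms k * w k)
    (5∤w : ∀ k → ¬ (+ 5 ∣ w k))
    (ms∣125 : ∀ k → + ms k ∣ + 125)
    where

    -- In a cyclic group of order m w, with m a power of 5 and w prime to 5, the Sylow 5-subgroup is
    -- generated by w; hence the weights.
    F : Lin r n
    F = extend S ∘ₗ diag w

    φ : Lin r n
    φ = to P ∘ₗ F

    F-index : ∀ x k → ap F x (index S k) ≡ w k * x k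
    F-index x k = extend-index S (w ⊗ x) k

    from-φ : ∀ x → ap (from P) (ap φ x) ≗ ap F x
    from-φ x = from-to P (ap F x)

    w≢0 : ∀ k → NonZero (w k)
    w≢0 k = ≢-nonZero (λ w≡0 → 5∤w k (divides (+ 0) w≡0))

    φ-image : ∀ x → (∀ k → + ms k ∣ x k) → InImage Mat (ap φ x)
    φ-image x ms∣x = image-diagonal (λ i → ∣-resp (sym (from-φ x i)) (d∣F i))
      where
      d∣F : ∀ i → d i ∣ ap F x i
      d∣F i with classify i
      ... | inj₂ (¬a , _) = divides (+ 0) (extend-outside S (w ⊗ x) i ¬a)
      ... | inj₁ a with complete S i a
      ...   | k , refl = case ms∣x k of λ { (divides q eq) → divides q
                (trans (F-index x k) (trans (cong (w k *_) eq) (trans (lem (w k) q (+ ms k)) (cong (q *_) (sym (factor k)))))) }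
        where
        lem : ∀ w q m → w * (q * m) ≡ q * (m * w)
        lem = solve-∀

    image-φ : ∀ x → InImage Mat (ap φ x) → ∀ k → + ms k ∣ x k
    image-φ x φx∈ k = case diagonal-image φx∈ (index S k) of λ { (divides q eq) → divides q
      (*-cancelˡ-≡ (w k) _ _ {{w≢0 k}} (trans (sym (F-index x k)) (trans (sym (from-φ x (index S k)))
        (trans eq (trans (cong (q *_) (factor k)) (lem q (+ ms k) (w k))))))) }
      where
      lem : ∀ q m w → q * (m * w) ≡ w * (q * m)
      lem = solve-∀

    image-resp : ∀ {x y} → x ≗ y → InImage Mat x → InImage Mat y
    image-resp x≗y (z , eq) = z , λ i → trans (eq i) (x≗y i)

    φ-surjective : ∀ y → InSyl5 Mat y → ∃ λ x → ap φ x ≈[ Mat ] y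
    φ-surjective y (p , 5ᵖy∈) = x , image-diagonal (λ i → ∣-resp (from-difference i) (d∣ i))
      where
      y′ = ap (from P) y
      d∣5ᵖy : ∀ i → d i ∣ + (5 ℕ.^ p) * y′ i
      d∣5ᵖy i = ∣-resp (ap-⊙ (from P) (+ (5 ℕ.^ p)) y i) (diagonal-image 5ᵖy∈ i)
      w∣y′ : ∀ k → w k ∣ y′ (index S k)
      w∣y′ k = cancel-power p (5∤w k) (∣-trans (divides (+ ms k) (factor k)) (d∣5ᵖy (index S k)))
      x : V r
      x k = _∣_.quotient (w∣y′ k)
      from-difference : ∀ i → ap F x i - y′ i ≡ ap (from P) (λ j → ap φ x j - y j) i
      from-difference i = trans (cong (_- y′ i) (sym (from-φ x i))) (ap-- (from P) (ap φ x) y i)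
      d∣ : ∀ i → d i ∣ ap F x i - y′ i
      d∣ i with classify i
      ... | inj₁ a with complete S i a
      ...   | k , refl = divides (+ 0) (trans (cong (_- y′ i) (trans (F-index x k)
                (trans (*-comm (w k) (x k)) (sym (_∣_.equality (w∣y′ k)))))) (+-inverseʳ (y′ i)))
      d∣ i | inj₂ (¬a , inj₁ d≡0) = divides (+ 0) (cong₂ _-_ (extend-outside S (w ⊗ x) i ¬a)
        (*-cancelˡ-≡ (+ (5 ℕ.^ p)) _ _ {{ℕ.m^n≢0 5 p}} (case d∣5ᵖy i of λ { (divides q eq) →
          trans eq (trans (cong (q *_) d≡0) (trans (*-zeroʳ q) (sym (*-zeroʳ (+ (5 ℕ.^ p)))))) })))
      d∣ i | inj₂ (¬a , inj₂ 5∤d) = ∣m∣n⇒∣m-n (divides (+ 0) (extend-outside S (w ⊗ x) i ¬a)) (cancel-power p 5∤d (d∣5ᵖy i))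

    syl5Iso : Syl5Iso Mat ms
    syl5Iso = ap φ
      , (λ x y x≈y → image-resp (λ i → sym (ap-- φ x y i)) (φ-image (λ k → x k - y k) (λ k → ∣ᵤ⇒∣ (x≈y k))))
      , (λ x y → image-diagonal (λ i → divides (+ 0) (trans
          (ap-cong (from P) (λ j → trans (cong (_- (ap φ x j + ap φ y j)) (ap-⊕ φ x y j)) (+-inverseʳ (ap φ x j + ap φ y j))) i) (ap-0 (from P) i))))
      -- 5³ = 125 annihilates every summand.
      , (λ x → 3 , image-resp (ap-⊙ φ (+ 125) x) (φ-image (+ 125 ⊙ x) (λ k → ∣m⇒∣m*n (x k) (ms∣125 k))))
      , (λ x y φ≈ k → ∣⇒∣ᵤ (image-φ (λ k → x k - y k) (image-resp (ap-- φ x y) φ≈) k))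
      , φ-surjective

-- From the Moore graph to its Laplacian.

Σℕ-pos : ∀ n (f : Fin n → ℕ) → Σℤ n (λ i → + f i) ≡ + Σℕ n f
Σℕ-pos zero    f = refl
Σℕ-pos (suc n) f = cong (_+_ (+ f zero)) (Σℕ-pos n (f ∘ suc))

module MooreLaplacian {n} (G : Graph n) (moore : MooreGraph G 2 57) where

  regular = proj₁ moore
  diameter = proj₁ (proj₁ (proj₂ moore))
  girth = proj₂ (proj₂ (proj₂ moore))

  vertex : Fin n
  vertex = proj₁ (proj₂ (proj₁ (proj₂ moore)))

  adjacent-≢ : ∀ {u v} → adj G u v ≡ true → u ≢ v
  adjacent-≢ {u} uv refl = case trans (sym uv) (irrefl G u) of λ ()

  flip-adj : ∀ {u v} → adj G u v ≡ true → adj G v u ≡ true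
  flip-adj {u} {v} uv = trans (adj-sym G v u) uv

  no-triangle : ∀ {u v w} → adj G u v ≡ true → adj G v w ≡ true → adj G w u ≡ true → ⊥
  no-triangle {u} {v} {w} uv vw wu = case girth 3 (ℕ.s≤s (ℕ.s≤s (ℕ.s≤s ℕ.z≤n)) , c , inj , edges , refl) of
    λ { (ℕ.s≤s (ℕ.s≤s (ℕ.s≤s ()))) }
    where
    c : ℕ → Fin n
    c 1 = v
    c 2 = w
    -- The default covers index 0 and also index 3, where the cycle closes.
    c _ = u
    inj : ∀ i j → i ℕ.< 3 → j ℕ.< 3 → c i ≡ c j → i ≡ j
    inj (suc (suc (suc _))) _ (ℕ.s≤s (ℕ.s≤s (ℕ.s≤s ()))) _ _
    inj _ (suc (suc (suc _))) _ (ℕ.s≤s (ℕ.s≤s (ℕ.s≤s ()))) _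
    inj 0 0 _ _ _ = refl
    inj 1 1 _ _ _ = refl
    inj 2 2 _ _ _ = refl
    inj 0 1 _ _ eq = ⊥-elim (adjacent-≢ uv eq)
    inj 1 0 _ _ eq = ⊥-elim (adjacent-≢ uv (sym eq))
    inj 1 2 _ _ eq = ⊥-elim (adjacent-≢ vw eq)
    inj 2 1 _ _ eq = ⊥-elim (adjacent-≢ vw (sym eq))
    inj 0 2 _ _ eq = ⊥-elim (adjacent-≢ wu (sym eq))
    inj 2 0 _ _ eq = ⊥-elim (adjacent-≢ wu eq)
    edges : ∀ i → i ℕ.< 3 → adj G (c i) (c (suc i)) ≡ true
    edges 0 _ = uv
    edges 1 _ = vw
    edges 2 _ = wu
    edges (suc (suc (suc _))) (ℕ.s≤s (ℕ.s≤s (ℕ.s≤s ())))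

  no-square : ∀ {a b x y} → adj G a b ≡ true → adj G b x ≡ true → adj G x y ≡ true → adj G y a ≡ true →
    a ≢ x → b ≢ y → ⊥
  no-square {a} {b} {x} {y} ab bx xy ya a≢x b≢y =
    case girth 4 (ℕ.s≤s (ℕ.s≤s (ℕ.s≤s ℕ.z≤n)) , c , inj , edges , refl) of
    λ { (ℕ.s≤s (ℕ.s≤s (ℕ.s≤s (ℕ.s≤s ())))) }
    where
    c : ℕ → Fin n
    c 1 = b
    c 2 = x
    c 3 = y
    -- The default covers index 0 and also index 4, where the cycle closes.
    c _ = a
    inj : ∀ i j → i ℕ.< 4 → j ℕ.< 4 → c i ≡ c j → i ≡ j
    inj (suc (suc (suc (suc _)))) _ (ℕ.s≤s (ℕ.s≤s (ℕ.s≤s (ℕ.s≤s ())))) _ _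
    inj _ (suc (suc (suc (suc _)))) _ (ℕ.s≤s (ℕ.s≤s (ℕ.s≤s (ℕ.s≤s ())))) _
    inj 0 0 _ _ _ = refl
    inj 1 1 _ _ _ = refl
    inj 2 2 _ _ _ = refl
    inj 3 3 _ _ _ = refl
    inj 0 1 _ _ eq = ⊥-elim (adjacent-≢ ab eq)
    inj 1 0 _ _ eq = ⊥-elim (adjacent-≢ ab (sym eq))
    inj 1 2 _ _ eq = ⊥-elim (adjacent-≢ bx eq)
    inj 2 1 _ _ eq = ⊥-elim (adjacent-≢ bx (sym eq))
    inj 2 3 _ _ eq = ⊥-elim (adjacent-≢ xy eq)
    inj 3 2 _ _ eq = ⊥-elim (adjacent-≢ xy (sym eq))
    inj 3 0 _ _ eq = ⊥-elim (adjacent-≢ ya eq)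
    inj 0 3 _ _ eq = ⊥-elim (adjacent-≢ ya (sym eq))
    inj 0 2 _ _ eq = ⊥-elim (a≢x eq)
    inj 2 0 _ _ eq = ⊥-elim (a≢x (sym eq))
    inj 1 3 _ _ eq = ⊥-elim (b≢y eq)
    inj 3 1 _ _ eq = ⊥-elim (b≢y (sym eq))
    edges : ∀ i → i ℕ.< 4 → adj G (c i) (c (suc i)) ≡ true
    edges 0 _ = ab
    edges 1 _ = bx
    edges 2 _ = xy
    edges 3 _ = ya
    edges (suc (suc (suc (suc _)))) (ℕ.s≤s (ℕ.s≤s (ℕ.s≤s (ℕ.s≤s ()))))

  common-neighbour : ∀ {u v} → u ≢ v → adj G u v ≡ false → ∃ λ w → adj G u w ≡ true × adj G w v ≡ true
  common-neighbour {u} {v} u≢v ¬uv with diameter u v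
  ... | 0 , _ , (w , w0 , wm , _) , _ = ⊥-elim (u≢v (trans (sym w0) wm))
  ... | 1 , _ , (w , refl , refl , step) , _ = case trans (sym ¬uv) (step 0 (ℕ.s≤s ℕ.z≤n)) of λ ()
  ... | 2 , _ , (w , refl , refl , step) , _ = w 1 , step 0 (ℕ.s≤s ℕ.z≤n) , step 1 (ℕ.s≤s (ℕ.s≤s ℕ.z≤n))
  ... | suc (suc (suc _)) , ℕ.s≤s (ℕ.s≤s ()) , _

  A : Fin n → V n
  A = adjℤ G

  A-sym : ∀ u v → A u v ≡ A v u
  A-sym u v = cong (λ b → + b2ℕ b) (adj-sym G u v)

  A-row : ∀ u → Σℤ n (A u) ≡ + 57
  A-row u = trans (Σℕ-pos n (λ w → b2ℕ (adj G u w))) (cong +_ (regular u))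

  A-product : ∀ {u w v} → ¬ (adj G u w ≡ true × adj G w v ≡ true) → A u w * A w v ≡ + 0
  A-product {u} {w} {v} ¬both with adj G u w | adj G w v
  ... | false | _     = refl
  ... | true  | false = refl
  ... | true  | true  = ⊥-elim (¬both (refl , refl))

  -- Counts common neighbours: the degree 57 on the diagonal; none for adjacent vertices, as there
  -- are no triangles; otherwise one, which exists by diameter 2 and is unique for lack of 4-cycles.
  A² : ∀ u v → Σℤ n (λ w → A u w * A w v) ≡ + 1 + (- + 1 * A u v + + 56 * unit u v)
  A² u v with u ≟ v
  ... | yes refl = trans (Σ-cong n (λ w → trans (cong (A u w *_) (A-sym w u)) (square (adj G u w))))
        (trans (A-row u) (cong (λ b → + 1 + (- + 1 * + b2ℕ b + + 56)) (sym (irrefl G u))))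
    where
    square : ∀ b → + b2ℕ b * + b2ℕ b ≡ + b2ℕ b
    square true  = refl
    square false = refl
  ... | no u≢v with adj G u v in uv
  ...   | true  = Σ-zero n (λ w → A-product (λ { (uw , wv) → no-triangle uv (flip-adj wv) (flip-adj uw) }))
  ...   | false with common-neighbour u≢v uv
  ...     | w , uw , wv = trans (Σ-single n w (λ x x≢w → A-product (λ { (ux , xv) →
              no-square uw wv (flip-adj xv) (flip-adj ux) u≢v (x≢w ∘ sym) })))
            (cong₂ (λ b c → + b2ℕ b * + b2ℕ c) uw wv)

  Aₗ : Lin n n
  Aₗ = combine A

  AA : ∀ x i → ap Aₗ (ap Aₗ x) i ≡ total x + (- + 1 * ap Aₗ x i + + 56 * x i)
  AA x i = trans (combine-image Aₗ A x i) (trans (Σ-cong n (λ k → trans (cong (x k *_) (A² k i)) (lem (x k) (A k i) (unit k i))))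
    (trans (Σ-+ n x _) (cong (_+_ (total x)) (trans (Σ-+ n (λ k → - + 1 * (x k * A k i)) _)
      (cong₂ _+_ (Σ-* n (- + 1) (λ k → x k * A k i)) (trans (Σ-* n (+ 56) (λ k → x k * unit k i)) (cong (+ 56 *_) (combine-unit x i))))))))
    where
    lem : ∀ x a e → x * (+ 1 + (- + 1 * a + + 56 * e)) ≡ x + (- + 1 * (x * a) + + 56 * (x * e))
    lem = solve-∀

  L : Lin n n
  L = + 57 *ₗ idₗ +ₗ (- + 1) *ₗ Aₗ

  L² : ∀ x i → ap L (ap L x) i ≡ total x + + 115 * ap L x i - + 3250 * x i
  L² x i = trans (cong (λ a → + 57 * ap L x i + - + 1 * a) (trans (ap-⊕ Aₗ (+ 57 ⊙ x) ((- + 1) ⊙ ap Aₗ x) i)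
      (cong₂ _+_ (ap-⊙ Aₗ (+ 57) x i) (trans (ap-⊙ Aₗ (- + 1) (ap Aₗ x) i) (cong (- + 1 *_) (AA x i))))))
    (lem (total x) (x i) (ap Aₗ x i))
    where
    lem : ∀ s x a → + 57 * (+ 57 * x + - + 1 * a) + - + 1 * (+ 57 * a + - + 1 * (s + (- + 1 * a + + 56 * x)))
                    ≡ s + + 115 * (+ 57 * x + - + 1 * a) - + 3250 * x
    lem = solve-∀

  L1 : ap L 1v ≗ 0v
  L1 i = cong (λ a → + 57 + - + 1 * a) (trans (Σ-cong n (λ k → trans (*-identityˡ (A k i)) (A-sym k i))) (A-row i))

  ΣL : ∀ x → total (ap L x) ≡ + 0
  ΣL x = trans (Σ-+ n (+ 57 ⊙ x) ((- + 1) ⊙ ap Aₗ x)) (trans (cong₂ _+_ (Σ-* n (+ 57) x) (trans (Σ-* n (- + 1) (ap Aₗ x)) (cong (- + 1 *_) ΣA))) (lem (total x)))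
    where
    ΣA : total (ap Aₗ x) ≡ total x * + 57
    ΣA = trans (Σ-swap n n (λ i k → x k * A k i)) (trans (Σ-cong n (λ k → trans (Σ-* n (x k) (A k)) (cong (x k *_) (A-row k)))) (constant x (+ 57)))
    lem : ∀ s → + 57 * s + - + 1 * (s * + 57) ≡ + 0
    lem = solve-∀

  A-unit : ∀ k i → ap Aₗ (unit k) i ≡ A k i
  A-unit k i = trans (Σ-single n k (λ j j≢k → trans (cong (_* A j i) (unit-≢ (j≢k ∘ sym))) (*-zeroˡ (A j i))))
    (trans (cong (_* A k i) (unit-≡ k)) (*-identityˡ (A k i)))

  L-diagonal : ∀ i → ap L (unit i) i ≡ + 57
  L-diagonal i = cong₂ (λ e a → + 57 * e + - + 1 * a) (unit-≡ i) (trans (A-unit i i) (cong (λ b → + b2ℕ b) (irrefl G i)))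

  -- At the all-ones vector the quadratic relation reads 0 = n - 3250.
  n≡3250 : n ≡ 3250
  n≡3250 = +-injective (trans (lem₁ (+ n)) (trans (cong (_+ + 3250) (trans (cong (λ s → s + + 115 * + 0 - + 3250 * + 1) (sym (Σ-const n (+ 1))))
      (trans (cong (λ l → total (1v {n}) + + 115 * l - + 3250 * + 1) (sym (L1 vertex)))
        (trans (sym (L² 1v vertex)) (trans (ap-cong L L1 vertex) (ap-0 L vertex)))))) (+-identityˡ (+ 3250))))
    where
    lem₁ : ∀ m → m ≡ m * + 1 + + 115 * + 0 - + 3250 * + 1 + + 3250
    lem₁ = solve-∀

  L-unit : ∀ k i → ap L (unit k) i ≡ laplacian G i k
  L-unit k i = trans (cong₂ (λ e a → e + - + 1 * a) (sym diagonal-entry) (trans (A-unit k i) (A-sym k i)))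
    (lem (if does (i ≟ k) then + degree G i else + 0) (A i k))
    where
    diagonal-entry : (if does (i ≟ k) then + degree G i else + 0) ≡ + 57 * unit k i
    diagonal-entry with i ≟ k
    ... | yes refl = trans (cong +_ (regular i)) (cong (+ 57 *_) (sym (unit-≡ i)))
    ... | no i≢k   = cong (+ 57 *_) (sym (unit-≢ (i≢k ∘ sym)))
    lem : ∀ a b → a + - + 1 * b ≡ a - b
    lem = solve-∀

  mooreOperator : MooreOperator (laplacian G)
  mooreOperator = record
    { L = L ; L-unit = L-unit ; L² = L² ; L1 = L1 ; ΣL = ΣL ; L-diagonal = L-diagonal ; o = vertex ; n≡3250 = n≡3250 }

-- Rank modulo 5 by columns.

¬¬-finite : ∀ {n} {A : Fin n → Set} → (∀ i → ¬ ¬ A i) → ¬ ¬ (∀ i → A i)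
¬¬-finite {zero}  ¬¬a k = k λ ()
¬¬-finite {suc n} ¬¬a k = ¬¬a zero λ a → ¬¬-finite (¬¬a ∘ suc) λ as → k λ { zero → a ; (suc i) → as i }

combination-∣ : ∀ n {m} (x f g : Fin n → ℤ) → (∀ k → m ∣ f k - g k) →
  m ∣ Σℤ n (λ k → x k * f k) - Σℤ n (λ k → x k * g k)
combination-∣ zero    x f g m∣ = divides (+ 0) refl
combination-∣ (suc n) x f g m∣ = ∣-resp (lem (x zero) (f zero) (g zero) _ _)
  (∣m∣n⇒∣m+n (∣n⇒∣m*n (x zero) (m∣ zero)) (combination-∣ n (x ∘ suc) (f ∘ suc) (g ∘ suc) (m∣ ∘ suc)))
  where
  lem : ∀ a b c s t → a * (b - c) + (s - t) ≡ a * b + s - (a * c + t)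
  lem = solve-∀

module Columns {n} (Mat : Fin n → Fin n → ℤ) (L : Lin n n) (L-unit : ∀ k i → ap L (unit k) i ≡ Mat i k) where

  columns : ∀ {r} → (Fin r → Fin n) → Lin r n
  columns s = combine (unit ∘ s)

  L-columns : ∀ {r} (s : Fin r → Fin n) c i → ap L (ap (columns s) c) i ≡ Σℤ r (λ j → c j * Mat i (s j))
  L-columns {r} s c i = trans (combine-image L (unit ∘ s) c i) (Σ-cong r (λ j → cong (c j *_) (L-unit (s j) i)))

  independent⇒inj5 : ∀ {r} (s : Fin r → Fin n) → ColsIndepMod5 Mat s → Inj5 (L ∘ₗ columns s)
  independent⇒inj5 s indep c 5∣ j = ∣ᵤ⇒∣ (indep c (λ i → ∣⇒∣ᵤ (∣-resp (L-columns s c i) (5∣ i))) j)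

  inj5⇒independent : ∀ {r} (s : Fin r → Fin n) → Inj5 (L ∘ₗ columns s) → ColsIndepMod5 Mat s
  inj5⇒independent s inj c 5∣ j = ∣⇒∣ᵤ (inj c (λ i → ∣-resp (sym (L-columns s c i)) (∣ᵤ⇒∣ (5∣ i))) j)

  Spanned : ∀ {r} → (Fin r → Fin n) → Fin n → Set
  Spanned {r} s j = ∃ λ (b : V r) → ∀ i → + 5 ∣ ap L (unit j) i - ap L (ap (columns s) b) i

  -- If column j were not spanned, adjoining it would keep independence, since a relation with
  -- leading coefficient prime to 5 could be solved for it. This yields a contradiction but no
  -- coefficients, hence the double negation.
  maximal⇒spanned : ∀ {r} (s : Fin r → Fin n) → Inj5 (L ∘ₗ columns s) →
    (∀ (t : Fin (suc r) → Fin n) → ¬ ColsIndepMod5 Mat t) → ∀ j → ¬ ¬ Spanned s j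
  maximal⇒spanned {r} s indep max j ¬spanned = max t (inj5⇒independent t inj)
    where
    t : Fin (suc r) → Fin n
    t zero    = j
    t (suc k) = s k
    inj : Inj5 (L ∘ₗ columns t)
    inj c 5∣ = case + 5 ∣? c zero of λ
      { (yes 5∣c₀) → λ { zero → 5∣c₀ ; (suc k) → indep (c ∘ suc) (λ i →
          ∣m+n∣m⇒∣n (∣-resp (split i) (5∣ i)) (∣m⇒∣m*n (ap L (unit j) i) 5∣c₀)) k }
      ; (no 5∤c₀) → case inverse5 (c zero) 5∤c₀ of λ { (a , 5∣ac₀-1) →
          ⊥-elim (¬spanned (((- a) ⊙ (c ∘ suc)) , λ i → ∣-resp
            (trans (lem a (c zero) (ap L (unit j) i) _) (cong (λ l → ap L (unit j) i - l) (sym (ap-⊙ (L ∘ₗ columns s) (- a) (c ∘ suc) i))))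
            (∣m∣n⇒∣m-n (∣n⇒∣m*n a (∣-resp (split i) (5∣ i))) (∣m⇒∣m*n (ap L (unit j) i) 5∣ac₀-1)))) }
      }
      where
      split : ∀ i → ap L (ap (columns t) c) i ≡ c zero * ap L (unit j) i + ap L (ap (columns s) (c ∘ suc)) i
      split i = trans (ap-⊕ L (c zero ⊙ unit j) (ap (columns s) (c ∘ suc)) i)
        (cong (_+ ap L (ap (columns s) (c ∘ suc)) i) (ap-⊙ L (c zero) (unit j) i))
      lem : ∀ a c l m → a * (c * l + m) - (a * c - + 1) * l ≡ l - (- a) * m
      lem = solve-∀

  coordinates : ∀ {r} (s : Fin r → Fin n) → (∀ j → Spanned s j) →
    ∃ λ (b : Lin n r) → ∀ x i → + 5 ∣ ap L x i - ap L (ap (columns s) (ap b x)) i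
  coordinates s spanned = combine (proj₁ ∘ spanned) , λ x i → ∣-resp
    (cong₂ _-_ (sym (expand L x i)) (sym (combine-image (L ∘ₗ columns s) (proj₁ ∘ spanned) x i)))
    (combination-∣ n x (λ k → ap L (unit k) i) _ (λ k → proj₂ (spanned k) i))

-- Sorting the diagonal entries by their power of 5.

-- A union of selections and `lookup` in a concatenation both branch on `splitAt`; this aligns the
-- diagonal entries with the order of `moduli`.
selection-∪-lookup : ∀ {n} {A B : Fin n → Set} {r s} (S : Selection A r) (T : Selection B s)
  (disjoint : ∀ i → A i → B i → ⊥) {X : Set} (xs : Vec X r) (ys : Vec X s) (R : Fin n → X → Set) →
  (∀ k → R (index S k) (lookup xs k)) → (∀ k → R (index T k) (lookup ys k)) →
  ∀ k → R (index (selection-∪ S T disjoint) k) (lookup (xs ++ ys) k)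
selection-∪-lookup {r = r} S T disjoint xs ys R f g k =
  subst (R _) (sym (lookup-splitAt r xs ys k)) (at (splitAt r k))
  where
  at : ∀ k → R ([ index S , index T ]′ k) ([ lookup xs , lookup ys ]′ k)
  at (inj₁ k) = f k
  at (inj₂ k) = g k

Factor : ℤ → ℕ → Set
Factor a m = ∃ λ w → a ≡ + m * w × ¬ (+ 5 ∣ w) × + m ∣ + 125

module Blocks {n} (d : V n) (d∣3250 : ∀ i → d i ≢ + 0 → d i ∣ + 3250) where

  -- `A₃` leaves out d = 0, which belongs to the free part of the cokernel.
  A₁ A₂ A₃ : Fin n → Set
  A₁ i = + 5 ∣ d i × ¬ (+ 25 ∣ d i)
  A₂ i = + 25 ∣ d i × ¬ (+ 125 ∣ d i)
  A₃ i = + 125 ∣ d i × d i ≢ + 0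

  A₁? : ∀ i → Dec (A₁ i)
  A₁? i = (+ 5 ∣? d i) ×-dec ¬? (+ 25 ∣? d i)
  A₂? : ∀ i → Dec (A₂ i)
  A₂? i = (+ 25 ∣? d i) ×-dec ¬? (+ 125 ∣? d i)
  A₃? : ∀ i → Dec (A₃ i)
  A₃? i = (+ 125 ∣? d i) ×-dec ¬? (d i ≟ℤ + 0)

  25⇒5 : ∀ {a} → + 25 ∣ a → + 5 ∣ a
  25⇒5 = ∣-trans (from-yes (+ 5 ∣? + 25))
  125⇒25 : ∀ {a} → + 125 ∣ a → + 25 ∣ a
  125⇒25 = ∣-trans (from-yes (+ 25 ∣? + 125))

  factor₁ : ∀ {i} → A₁ i → Factor (d i) 5
  factor₁ (divides q eq , 25∤d) = q , trans eq (*-comm q (+ 5)) ,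
    (λ { (divides p refl) → 25∤d (divides p (trans eq (*-assoc p (+ 5) (+ 5)))) }) , from-yes (+ 5 ∣? + 125)
  factor₂ : ∀ {i} → A₂ i → Factor (d i) 25
  factor₂ (divides q eq , 125∤d) = q , trans eq (*-comm q (+ 25)) ,
    (λ { (divides p refl) → 125∤d (divides p (trans eq (*-assoc p (+ 5) (+ 25)))) }) , from-yes (+ 25 ∣? + 125)
  factor₃ : ∀ {i} → A₃ i → Factor (d i) 125
  factor₃ {i} (divides q eq , d≢0) = q , trans eq (*-comm q (+ 125)) ,
    -- If 5 ∣ q, then 625 would divide 3250 = 2·5³·13.
    (λ { (divides p refl) → from-no (+ 625 ∣? + 3250)
      (∣-trans (divides p (trans eq (*-assoc p (+ 5) (+ 125)))) (d∣3250 i d≢0)) }) , from-yes (+ 125 ∣? + 125)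

  a b c : ℕ
  a = count A₁?
  b = count A₂?
  c = count A₃?

  A : Fin n → Set
  A i = A₁ i ⊎ (A₂ i ⊎ A₃ i)

  disjoint₂₃ : ∀ i → A₂ i → A₃ i → ⊥
  disjoint₂₃ i (_ , 125∤d) (125∣d , _) = 125∤d 125∣d

  disjoint₁ : ∀ i → A₁ i → A₂ i ⊎ A₃ i → ⊥
  disjoint₁ i (_ , 25∤d) (inj₁ (25∣d , _))  = 25∤d 25∣d
  disjoint₁ i (_ , 25∤d) (inj₂ (125∣d , _)) = 25∤d (125⇒25 125∣d)

  S₂₃ : Selection (λ i → A₂ i ⊎ A₃ i) (b ℕ.+ c)
  S₂₃ = selection-∪ (select A₂?) (select A₃?) disjoint₂₃

  S : Selection A (a ℕ.+ (b ℕ.+ c))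
  S = selection-∪ (select A₁?) S₂₃ disjoint₁

  factor : ∀ k → Factor (d (index S k)) (moduli a b c k)
  factor = selection-∪-lookup (select A₁?) S₂₃ disjoint₁ (replicate a 5) (replicate b 25 ++ replicate c 125) (λ i → Factor (d i))
    (λ k → subst (Factor _) (sym (lookup-replicate k 5)) (factor₁ (sound (select A₁?) k)))
    (selection-∪-lookup (select A₂?) (select A₃?) disjoint₂₃ (replicate b 25) (replicate c 125) (λ i → Factor (d i))
      (λ k → subst (Factor _) (sym (lookup-replicate k 25)) (factor₂ (sound (select A₂?) k)))
      (λ k → subst (Factor _) (sym (lookup-replicate k 125)) (factor₃ (sound (select A₃?) k))))

  classify : ∀ i → A i ⊎ (¬ A i × (d i ≡ + 0 ⊎ ¬ (+ 5 ∣ d i)))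
  classify i with + 5 ∣? d i | + 25 ∣? d i | + 125 ∣? d i | d i ≟ℤ + 0
  ... | no 5∤d | _ | _ | _ = inj₂ ((λ { (inj₁ (5∣d , _)) → 5∤d 5∣d ; (inj₂ (inj₁ (25∣d , _))) → 5∤d (25⇒5 25∣d)
                                      ; (inj₂ (inj₂ (125∣d , _))) → 5∤d (25⇒5 (125⇒25 125∣d)) }) , inj₂ 5∤d)
  ... | yes 5∣d | no 25∤d | _ | _ = inj₁ (inj₁ (5∣d , 25∤d))
  ... | yes _ | yes 25∣d | no 125∤d | _ = inj₁ (inj₂ (inj₁ (25∣d , 125∤d)))
  ... | yes _ | yes _ | yes 125∣d | no d≢0 = inj₁ (inj₂ (inj₂ (125∣d , d≢0)))
  ... | yes _ | yes 25∣d | yes 125∣d | yes d≡0 = inj₂ ((λ { (inj₁ (_ , 25∤d)) → 25∤d 25∣d ; (inj₂ (inj₁ (_ , 125∤d))) → 125∤d 125∣d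
                                      ; (inj₂ (inj₂ (_ , d≢0))) → d≢0 d≡0 }) , inj₁ d≡0)

  a+#[5∤d] : ∀ {r s} → Selection (λ i → ¬ (+ 5 ∣ d i)) r → Selection (λ i → ¬ (+ 25 ∣ d i)) s → a ℕ.+ r ≡ s
  a+#[5∤d] S₀ T = selection-≡ (selection-∪ (select A₁?) S₀ (λ { i (5∣d , _) 5∤d → 5∤d 5∣d })) T
    (λ { i (inj₁ (_ , 25∤d)) → 25∤d ; i (inj₂ 5∤d) → 5∤d ∘ 25⇒5 })
    (λ i 25∤d → case + 5 ∣? d i of λ { (yes 5∣d) → inj₁ (5∣d , 25∤d) ; (no 5∤d) → inj₂ 5∤d })

  b+#[125∣d] : ∀ {r s} → Selection (λ i → + 125 ∣ d i) r → Selection (λ i → + 25 ∣ d i) s → b ℕ.+ r ≡ s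
  b+#[125∣d] S₃ T = selection-≡ (selection-∪ (select A₂?) S₃ (λ { i (_ , 125∤d) 125∣d → 125∤d 125∣d })) T
    (λ { i (inj₁ (25∣d , _)) → 25∣d ; i (inj₂ 125∣d) → 125⇒25 125∣d })
    (λ i 25∣d → case + 125 ∣? d i of λ { (yes 125∣d) → inj₂ 125∣d ; (no 125∤d) → inj₁ (25∣d , 125∤d) })

  c+#[d≡0] : ∀ {r s} → Selection (λ i → d i ≡ + 0) r → Selection (λ i → + 125 ∣ d i) s → c ℕ.+ r ≡ s
  c+#[d≡0] Sz T = selection-≡ (selection-∪ (select A₃?) Sz (λ { i (_ , d≢0) d≡0 → d≢0 d≡0 })) T
    (λ { i (inj₁ (125∣d , _)) → 125∣d ; i (inj₂ d≡0) → divides (+ 0) d≡0 })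
    (λ i 125∣d → case d i ≟ℤ + 0 of λ { (yes d≡0) → inj₂ d≡0 ; (no d≢0) → inj₁ (125∣d , d≢0) })

  #[25∣d]+#[25∤d] : ∀ {r s} → Selection (λ i → + 25 ∣ d i) r → Selection (λ i → ¬ (+ 25 ∣ d i)) s → r ℕ.+ s ≡ n
  #[25∣d]+#[25∤d] T T′ = selection-≡ (selection-∪ T T′ (λ i 25∣d 25∤d → 25∤d 25∣d)) (selection-all {A = λ _ → ⊤} (λ _ → tt))
    (λ _ _ → tt) (λ i _ → case + 25 ∣? d i of λ { (yes 25∣d) → inj₁ 25∣d ; (no 25∤d) → inj₂ 25∤d })

-- Determining the multiplicities.

squeeze : ∀ {m m′ k k′} → k ℕ.≤ m → k′ ℕ.≤ m′ → m ℕ.+ m′ ≡ k ℕ.+ k′ → m ≡ k × m′ ≡ k′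
squeeze {m} {m′} {k} {k′} k≤m k′≤m′ eq = m≡k , ℕ.+-cancelˡ-≡ k m′ k′ (trans (cong (ℕ._+ m′) (sym m≡k)) eq)
  where
  m≡k : m ≡ k
  m≡k = ℕ.≤-antisym (ℕ.+-cancelʳ-≤ k′ m k (ℕ.≤-trans (ℕ.+-monoʳ-≤ m k′≤m′) (ℕ.≤-reflexive eq))) k≤m

module _ {n} {Mat : Fin n → Fin n → ℤ} (MO : MooreOperator Mat) (e : ℕ) (rank : RankMod5 Mat e) where
  open MooreOperator MO
  open Moore MO
  open Columns Mat L L-unit

  L≗Mat : ∀ x → ap L x ≗ Mat ·v x
  L≗Mat x i = trans (expand L x i)
    (Σ-cong n (λ k → trans (cong (x k *_) (L-unit k i)) (*-comm (x k) (Mat i k))))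

  module _ (D : Diagonalization L) where
    open Diagonal D using (d)
    open Blocks d (d∣3250 D)
    open Cokernel Mat L L≗Mat D

    syl5-from-diagonal : ∃ λ a → ∃ λ b → ∃ λ c →
      (a ℕ.+ e ≡ 1521) × (b ℕ.+ e ≡ 1730) × (c ℕ.+ 2 ≡ e) × Syl5Iso Mat (moduli a b c)
    syl5-from-diagonal = a , b , c , a+e , b+e , c+2 ,
      syl5Iso S (moduli a b c) (proj₁ ∘ factor) classify (proj₁ ∘ proj₂ ∘ factor)
        (proj₁ ∘ proj₂ ∘ proj₂ ∘ factor) (proj₂ ∘ proj₂ ∘ proj₂ ∘ factor)
      where
      S₀ = select (λ i → ¬? (+ 5 ∣? d i))
      S₂₅ = select (λ i → + 25 ∣? d i)
      S₂₅′ = select (λ i → ¬? (+ 25 ∣? d i))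
      S₁₂₅ = select (λ i → + 125 ∣? d i)
      S∞ = select (λ i → d i ≟ℤ + 0)
      r₀ = count (λ i → ¬? (+ 5 ∣? d i))
      r₁₂₅ = count (λ i → + 125 ∣? d i)
      s = proj₁ (proj₁ rank)
      independent = independent⇒inj5 s (proj₂ (proj₁ rank))
      -- Maximality of s puts each column in the span of s only up to double negation, which suffices
      -- because there are finitely many columns and r₀ ℕ.≤ e is decidable.
      r₀≤e : r₀ ℕ.≤ e
      r₀≤e = decidable-stable (r₀ ℕ.≤? e) λ r₀≰e →
        ¬¬-finite (maximal⇒spanned s independent (proj₂ rank)) λ spanned →
          r₀≰e (≤rank D (columns s) (proj₁ (coordinates s spanned)) (proj₂ (coordinates s spanned)) S₀)
      -- The cycle suc r₁₂₅ ≤ r₀ ≤ e ≤ suc r₁₂₅ forces equality throughout.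
      r₁₂₅+1≡e : suc r₁₂₅ ≡ e
      r₁₂₅+1≡e = ℕ.≤-antisym (ℕ.≤-trans (kernel125< D S₁₂₅ S₀) r₀≤e) (rank≤ D (columns s) independent S₁₂₅)
      r₀≡e : r₀ ≡ e
      r₀≡e = ℕ.≤-antisym r₀≤e (ℕ.≤-trans (ℕ.≤-reflexive (sym r₁₂₅+1≡e)) (kernel125< D S₁₂₅ S₀))
      sizes : count (λ i → + 25 ∣? d i) ≡ 1729 × count (λ i → ¬? (+ 25 ∣? d i)) ≡ 1521
      sizes = squeeze
        (eigenspace50≤ D eigenspace50 S₂₅)
        (eigenspace65< D eigenspace65 S₂₅′)
        (trans (#[25∣d]+#[25∤d] S₂₅ S₂₅′) n≡3250)
      a+e : a ℕ.+ e ≡ 1521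
      a+e = trans (cong (a ℕ.+_) (sym r₀≡e)) (trans (a+#[5∤d] S₀ S₂₅′) (proj₂ sizes))
      -- One more than the 1729 indices with 25 ∣ d, because e = r₁₂₅ + 1.
      b+e : b ℕ.+ e ≡ 1730
      b+e = trans (cong (b ℕ.+_) (sym r₁₂₅+1≡e)) (trans (ℕ.+-suc b r₁₂₅) (cong suc (trans (b+#[125∣d] S₁₂₅ S₂₅) (proj₁ sizes))))
      -- The 2 is made up of the single index with d = 0 and the shift e = r₁₂₅ + 1.
      c+2 : c ℕ.+ 2 ≡ e
      c+2 = trans (ℕ.+-suc c 1) (trans (cong suc (trans (cong (c ℕ.+_) (sym (corank≡1 D S∞))) (c+#[d≡0] S∞ S₁₂₅))) r₁₂₅+1≡e)

theoremB : ∀ (n : ℕ) (G : Graph n) → MooreGraph G 2 57 →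
    ∀ (e0 : ℕ) → RankMod5 (laplacian G) e0 →
    (∃ λ a → ∃ λ b → ∃ λ c →
    (a ℕ.+ e0 ≡ 1520) × (b ℕ.+ e0 ≡ 1732) × (c ℕ.+ 3 ≡ e0) × Syl5Type G a b c)
    ⊎
    (∃ λ a → ∃ λ b → ∃ λ c →
    (a ℕ.+ e0 ≡ 1521) × (b ℕ.+ e0 ≡ 1730) × (c ℕ.+ 2 ≡ e0) × Syl5Type G a b c)
theoremB n G moore e0 rank = inj₂ (syl5-from-diagonal mooreOperator e0 rank (diagonalize L))
  where
  open MooreLaplacian G moore
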